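{- For every integer $n\geq 2$, $$D_n(x)=\frac{1}{2}\sum_{k=1}^{n-1}R(n,k)x^k(1-x)^{n-1-k}.$$ Equivalently, for every integer $n\ge 2$, $$R_n(x)=2(1+x)^{n-1}D_n\left(\frac{x}{1+x}\right).$$
   Context: $\mathfrak{S}_n$ is the set of permutations $\pi=\pi(1)\cdots\pi(n)$ of $\{1,\ldots,n\}$. Alternating runs: $\pi$ changes direction at position $i\in\{2,\ldots,n-1\}$ if $\pi(i-1)<\pi(i)>\pi(i+1)$ or $\pi(i-1)>\pi(i)<\pi(i+1)$. For $n\ge 2$, $\pi$ has $k$ alternating runs if it changes direction at exactly $k-1$ positions; $R(n,k)$ is the number of $\pi\in\mathfrak{S}_n$ with $k$ alternating runs, and $R_n(x)=\sum_{k=1}^{n-1}R(n,k)x^k$. André permutations: $\pi\in\mathfrak{S}_n$ is an André permutation if (1) there is no $i\in\{2,\ldots,n-1\}$ with $\pi(i-1)>\pi(i)>\pi(i+1)$; and (2) for all $j,j'\in\{2,\ldots,n\}$ with $j<j'$, if $\pi(j-1)=\max\{\pi(j-1),\pi(j),\pi(j'-1),\pi(j')\}$ and $\pi(j')=\min\{\pi(j-1),\pi(j),\pi(j'-1),\pi(j')\}$, then there is $j''$ with $j<j''<j'$ and $\pi(j'')<\pi(j')$. An augmented André permutation is an André permutation with $\pi(n)=n$; $\mathfrak{A}_n$ is the set of augmented André permutations in $\mathfrak{S}_n$. A left peak of $\pi\in\mathfrak{S}_n$ is an index $i\in\{1,\ldots,n-1\}$ with $\pi(i-1)<\pi(i)>\pi(i+1)$,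 where $\pi(0)=0$. $d(n,k)$ is the number of permutations in $\mathfrak{A}_n$ with exactly $k-1$ left peaks, and $D_n(x)=\sum_{k\ge 1}d(n,k)x^k$. (For example $D_2(x)=x$, $D_3(x)=x+x^2$, $D_4(x)=x+4x^2$.) -}

module Defs where

open import Algebra.Bundles.Raw using (RawRing)
import Algebra.Definitions.RawSemiring as RawSemiringDefs
open import Data.Fin.Base using (Fin; toℕ)
import Data.Fin.Properties as Fin
open import Data.List.Base
  using (List; []; _∷_; [_]; map; foldr; filter; length; drop; allFin; applyUpTo; cartesianProductWith)
import Data.List.Properties as List
open import Data.List.Relation.Unary.All as All using (All)
open import Data.List.Relation.Unary.Any as Any using (Any)
open import Data.Nat.Base as ℕ using (ℕ; zero; suc; _∸_; _⊔_; _⊓_; _≤_; _<_; s≤s)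
import Data.Nat.Properties as ℕ
open import Data.Product.Base using (_×_; _,_)
open import Data.Rational.Base as ℚ using (ℚ; 0ℚ; 1ℚ)
import Data.Rational.Properties as ℚ
open import Data.Sum.Base using (_⊎_)
open import Data.Vec.Base as Vec using (Vec)
import Data.Vec.Relation.Unary.AllPairs as AllPairs
open import Data.Vec.Relation.Unary.Unique.Propositional using (Unique)
open import Level using (0ℓ)
open import Relation.Binary.PropositionalEquality
  using (_≡_; _≢_; refl; sym; trans; cong; module ≡-Reasoning)
open import Relation.Nullary using (Dec; ¬_; yes; no; ¬?; contradiction)
open import Relation.Nullary.Decidable using (_×-dec_; _⊎-dec_; _→-dec_)
open import Relation.Unary using (Decidable)

-- The integers i with a ≤ i ≤ b, in increasing order (empty if b < a).
interval : ℕ → ℕ → List ℕ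
interval a b = applyUpTo (λ i → a ℕ.+ i) (suc b ∸ a)

count : ∀ {A : Set} {P : A → Set} → Decidable P → List A → ℕ
count P? xs = length (filter P? xs)

------------------------------------------------------------------------
-- Permutations

-- All words of length m over the alphabet Fin n, each listed once.
words : (n m : ℕ) → List (Vec (Fin n) m)
words n zero    = [ Vec.[] ]
words n (suc m) = cartesianProductWith Vec._∷_ (allFin n) (words n m)

unique? : ∀ {n m} → Decidable (Unique {A = Fin n} {n = m})
unique? = AllPairs.allPairs? λ a b → ¬? (a Fin.≟ b)

-- A permutation in one-line notation is a word of length n over n
-- letters without repetitions.
𝔖 : (n : ℕ) → List (Vec (Fin n) n)
𝔖 n = filter unique? (words n n)

-- π ⟨ i ⟩ is π(i) with positions and values numbered from 1, so the
-- element a of Fin n stands for the value 1 + toℕ a.  The clause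
-- π(0) = 0 is the convention used for left peaks; the value 0 at
-- positions beyond the length is never consulted.
_⟨_⟩ : ∀ {n m} → Vec (Fin n) m → ℕ → ℕ
π             ⟨ zero ⟩        = 0
Vec.[]        ⟨ suc i ⟩       = 0
(a Vec.∷ π)   ⟨ suc zero ⟩    = suc (toℕ a)
(a Vec.∷ π)   ⟨ suc (suc i) ⟩ = π ⟨ suc i ⟩

------------------------------------------------------------------------
-- Alternating runs

module _ {n : ℕ} (π : Vec (Fin n) n) where

  Peak Valley DoubleDescent : ℕ → Set
  Peak          i = π ⟨ i ∸ 1 ⟩ < π ⟨ i ⟩ × π ⟨ suc i ⟩ < π ⟨ i ⟩
  Valley        i = π ⟨ i ⟩ < π ⟨ i ∸ 1 ⟩ × π ⟨ i ⟩ < π ⟨ suc i ⟩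
  DoubleDescent i = π ⟨ i ⟩ < π ⟨ i ∸ 1 ⟩ × π ⟨ suc i ⟩ < π ⟨ i ⟩

  peak? : Decidable Peak
  peak? i = (_ ℕ.<? _) ×-dec (_ ℕ.<? _)

  valley? : Decidable Valley
  valley? i = (_ ℕ.<? _) ×-dec (_ ℕ.<? _)

  doubleDescent? : Decidable DoubleDescent
  doubleDescent? i = (_ ℕ.<? _) ×-dec (_ ℕ.<? _)

  directionChanges : ℕ
  directionChanges = count (λ i → peak? i ⊎-dec valley? i) (interval 2 (n ∸ 1))

  -- Meaningful for n ≥ 2 only.
  alternatingRuns : ℕ
  alternatingRuns = suc directionChanges

  leftPeaks : ℕ
  leftPeaks = count peak? (interval 1 (n ∸ 1))

-- The number usually written R(n,k); R is the polynomial below.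
r : ℕ → ℕ → ℕ
r n k = count (λ π → alternatingRuns π ℕ.≟ k) (𝔖 n)

------------------------------------------------------------------------
-- Augmented André permutations

module _ {n : ℕ} (π : Vec (Fin n) n) where

  Extremal : ℕ → ℕ → Set
  Extremal j j′ =
    π ⟨ j ∸ 1 ⟩ ≡ π ⟨ j ∸ 1 ⟩ ⊔ π ⟨ j ⟩ ⊔ π ⟨ j′ ∸ 1 ⟩ ⊔ π ⟨ j′ ⟩ ×
    π ⟨ j′ ⟩    ≡ π ⟨ j ∸ 1 ⟩ ⊓ π ⟨ j ⟩ ⊓ π ⟨ j′ ∸ 1 ⟩ ⊓ π ⟨ j′ ⟩

  -- The interval consists of the j″ with j < j″ < j′.
  SmallerBetween : ℕ → ℕ → Set
  SmallerBetween j j′ =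
    Any (λ j″ → π ⟨ j″ ⟩ < π ⟨ j′ ⟩) (interval (suc j) (j′ ∸ 1))

  IsAndré : Set
  IsAndré =
    ¬ Any (DoubleDescent π) (interval 2 (n ∸ 1)) ×
    All (λ j → All (λ j′ → j < j′ → Extremal j j′ → SmallerBetween j j′)
                   (interval 2 n))
        (interval 2 n)

  IsAugmentedAndré : Set
  IsAugmentedAndré = IsAndré × π ⟨ n ⟩ ≡ n

  isAugmentedAndré? : Dec IsAugmentedAndré
  isAugmentedAndré? =
    (¬? (Any.any? (doubleDescent? π) _) ×-dec
     All.all? (λ j → All.all? (λ j′ →
       (j ℕ.<? j′) →-dec
       ((_ ℕ.≟ _) ×-dec (_ ℕ.≟ _)) →-dec
       Any.any? (λ j″ → _ ℕ.<? _) _) _) _)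
    ×-dec (_ ℕ.≟ _)

𝔄 : (n : ℕ) → List (Vec (Fin n) n)
𝔄 n = filter isAugmentedAndré? (𝔖 n)

d : ℕ → ℕ → ℕ
d n k = count (λ π → suc (leftPeaks π) ℕ.≟ k) (𝔄 n)

-- This justifies ending the sum over all k ≥ 1 that defines Dₙ at k = n.
d-vanishes : ∀ n k → 1 ≤ n → n < k → d n k ≡ 0
d-vanishes (suc n) k _ n<k =
  cong length (List.filter-none (λ π → suc (leftPeaks π) ℕ.≟ k)
                                (All.universal tooFew (𝔄 (suc n))))
  where
  leftPeaks≤ : ∀ π → leftPeaks {suc n} π ≤ n
  leftPeaks≤ π = ℕ.≤-trans (List.length-filter (peak? π) (interval 1 n))
                           (ℕ.≤-reflexive (List.length-applyUpTo suc n))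

  tooFew : ∀ π → ¬ suc (leftPeaks {suc n} π) ≡ k
  tooFew π refl = ℕ.<⇒≱ n<k (s≤s (leftPeaks≤ π))

------------------------------------------------------------------------
-- The generating polynomials, as expressions in a ring

module InRing (A : RawRing 0ℓ 0ℓ) where

  open RawRing A public
  open RawSemiringDefs rawSemiring public using (_^_) renaming (_×_ to infixr 8 _·_)

  infixl 6 _-_
  _-_ : Carrier → Carrier → Carrier
  a - b = a + (- b)

  infixr 5 ∑
  ∑ : List ℕ → (ℕ → Carrier) → Carrier
  ∑ ks f = foldr _+_ 0# (map f ks)

  syntax ∑ ks (λ k → t) = ∑[ k ∈ ks ] t

  R : ℕ → Carrier → Carrier
  R n x = ∑[ k ∈ interval 1 (n ∸ 1) ] r n k · x ^ k

  D : ℕ → Carrier → Carrier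
  D n x = ∑[ k ∈ interval 1 n ] d n k · x ^ k

------------------------------------------------------------------------
-- ℚ[x]

-- Coefficient lists, constant term first; trailing zeros are allowed,
-- so equality is equality of all coefficients.
Poly : Set
Poly = List ℚ

coeff : Poly → ℕ → ℚ
coeff []      _       = 0ℚ
coeff (a ∷ p) zero    = a
coeff (a ∷ p) (suc i) = coeff p i

infix  4 _≈ₚ_
infixl 6 _+ₚ_
infixl 7 _*ₚ_

_≈ₚ_ : Poly → Poly → Set
p ≈ₚ q = ∀ i → coeff p i ≡ coeff q i

_+ₚ_ : Poly → Poly → Poly
[]      +ₚ q       = q
(a ∷ p) +ₚ []      = a ∷ p
(a ∷ p) +ₚ (b ∷ q) = a ℚ.+ b ∷ p +ₚ q

-ₚ_ : Poly → Poly
-ₚ_ = map (λ a → ℚ.- a)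

_*ₚ_ : Poly → Poly → Poly
[]      *ₚ q = []
(a ∷ p) *ₚ q = map (a ℚ.*_) q +ₚ (0ℚ ∷ p *ₚ q)

const : ℚ → Poly
const a = a ∷ []

X : Poly
X = 0ℚ ∷ 1ℚ ∷ []

ℚ[x] : RawRing 0ℓ 0ℓ
ℚ[x] = record
  { Carrier = Poly
  ; _≈_     = _≈ₚ_
  ; _+_     = _+ₚ_
  ; _*_     = _*ₚ_
  ; -_      = -ₚ_
  ; 0#      = []
  ; 1#      = const 1ℚ
  }

NonZeroₚ : Poly → Set
NonZeroₚ p = ¬ p ≈ₚ []

coeff-+ : ∀ p q i → coeff (p +ₚ q) i ≡ coeff p i ℚ.+ coeff q i
coeff-+ []      q       i       = sym (ℚ.+-identityˡ _)
coeff-+ (a ∷ p) []      i       = sym (ℚ.+-identityʳ _)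
coeff-+ (a ∷ p) (b ∷ q) zero    = refl
coeff-+ (a ∷ p) (b ∷ q) (suc i) = coeff-+ p q i

coeff-scale : ∀ a p i → coeff (map (a ℚ.*_) p) i ≡ a ℚ.* coeff p i
coeff-scale a []      i       = sym (ℚ.*-zeroʳ a)
coeff-scale a (b ∷ p) zero    = refl
coeff-scale a (b ∷ p) (suc i) = coeff-scale a p i

coeff-*-zero : ∀ a p q → coeff ((a ∷ p) *ₚ q) 0 ≡ a ℚ.* coeff q 0
coeff-*-zero a p q = begin
  coeff ((a ∷ p) *ₚ q) 0               ≡⟨ coeff-+ (map (a ℚ.*_) q) _ 0 ⟩
  coeff (map (a ℚ.*_) q) 0 ℚ.+ 0ℚ      ≡⟨ ℚ.+-identityʳ _ ⟩
  coeff (map (a ℚ.*_) q) 0             ≡⟨ coeff-scale a q 0 ⟩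
  a ℚ.* coeff q 0                      ∎
  where open ≡-Reasoning

coeff-*-suc : ∀ a p q i → coeff ((a ∷ p) *ₚ q) (suc i) ≡
              a ℚ.* coeff q (suc i) ℚ.+ coeff (p *ₚ q) i
coeff-*-suc a p q i = begin
  coeff ((a ∷ p) *ₚ q) (suc i)
    ≡⟨ coeff-+ (map (a ℚ.*_) q) _ (suc i) ⟩
  coeff (map (a ℚ.*_) q) (suc i) ℚ.+ coeff (p *ₚ q) i
    ≡⟨ cong (ℚ._+ _) (coeff-scale a q (suc i)) ⟩
  a ℚ.* coeff q (suc i) ℚ.+ coeff (p *ₚ q) i ∎
  where open ≡-Reasoning

coeff-*-shift : ∀ p q → coeff q 0 ≡ 0ℚ → ∀ i →
                coeff (p *ₚ q) (suc i) ≡ coeff (p *ₚ drop 1 q) i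
coeff-*-shift []      q q₀≡0 i = refl
coeff-*-shift (a ∷ p) q q₀≡0 i = begin
  coeff ((a ∷ p) *ₚ q) (suc i)                   ≡⟨ coeff-*-suc a p q i ⟩
  a ℚ.* coeff q (suc i) ℚ.+ coeff (p *ₚ q) i     ≡⟨ cong (λ c → a ℚ.* c ℚ.+ coeff (p *ₚ q) i) (coeff-drop q i) ⟩
  a ℚ.* coeff q′ i ℚ.+ coeff (p *ₚ q) i          ≡⟨ step i ⟩
  coeff ((a ∷ p) *ₚ q′) i                        ∎
  where
  open ≡-Reasoning
  q′ = drop 1 q

  coeff-drop : ∀ q i → coeff q (suc i) ≡ coeff (drop 1 q) i
  coeff-drop []      i = refl
  coeff-drop (b ∷ q) i = refl

  const-term : ∀ p → coeff (p *ₚ q) 0 ≡ 0ℚ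
  const-term []      = refl
  const-term (b ∷ p) =
    trans (coeff-*-zero b p q) (trans (cong (b ℚ.*_) q₀≡0) (ℚ.*-zeroʳ b))

  step : ∀ i → a ℚ.* coeff q′ i ℚ.+ coeff (p *ₚ q) i ≡ coeff ((a ∷ p) *ₚ q′) i
  step zero    = trans (cong (a ℚ.* coeff q′ 0 ℚ.+_) (const-term p))
                       (trans (ℚ.+-identityʳ _) (sym (coeff-*-zero a p q′)))
  step (suc i) = trans (cong (a ℚ.* coeff q′ (suc i) ℚ.+_) (coeff-*-shift p q q₀≡0 i))
                       (sym (coeff-*-suc a p q′ i))

ℚ-cancel : ∀ a b → a ≢ 0ℚ → a ℚ.* b ≡ 0ℚ → b ≡ 0ℚ
ℚ-cancel a b a≢0 ab≡0 = begin
  b                       ≡⟨ ℚ.*-identityˡ b ⟨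
  1ℚ ℚ.* b                ≡⟨ cong (ℚ._* b) (ℚ.*-inverseˡ a) ⟨
  (ℚ.1/ a ℚ.* a) ℚ.* b    ≡⟨ ℚ.*-assoc (ℚ.1/ a) a b ⟩
  ℚ.1/ a ℚ.* (a ℚ.* b)    ≡⟨ cong (ℚ.1/ a ℚ.*_) ab≡0 ⟩
  ℚ.1/ a ℚ.* 0ℚ           ≡⟨ ℚ.*-zeroʳ (ℚ.1/ a) ⟩
  0ℚ                      ∎
  where
  open ≡-Reasoning
  instance _ = ℚ.≢-nonZero a≢0

*ₚ-cancel : ∀ p q → NonZeroₚ p → p *ₚ q ≈ₚ [] → q ≈ₚ []
*ₚ-cancel []      q  p≢0 pq≈0 = contradiction (λ _ → refl) p≢0
*ₚ-cancel (a ∷ p) q ap≢0 pq≈0 with a ℚ.≟ 0ℚ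
... | yes refl = *ₚ-cancel p q
        (λ p≈0 → ap≢0 λ { zero → refl ; (suc i) → p≈0 i })
        (λ i → begin
          coeff (p *ₚ q) i                               ≡⟨ ℚ.+-identityˡ _ ⟨
          0ℚ ℚ.+ coeff (p *ₚ q) i                        ≡⟨ cong (ℚ._+ coeff (p *ₚ q) i) (ℚ.*-zeroˡ (coeff q (suc i))) ⟨
          0ℚ ℚ.* coeff q (suc i) ℚ.+ coeff (p *ₚ q) i    ≡⟨ coeff-*-suc 0ℚ p q i ⟨
          coeff ((0ℚ ∷ p) *ₚ q) (suc i)                  ≡⟨ pq≈0 (suc i) ⟩
          0ℚ                                             ∎)
  where open ≡-Reasoning
... | no a≢0 = go q pq≈0
  where
  go : ∀ q → (a ∷ p) *ₚ q ≈ₚ [] → q ≈ₚ []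
  go []      _    i       = refl
  go (b ∷ q) pq≈0 zero    = ℚ-cancel a b a≢0 (trans (sym (coeff-*-zero a p (b ∷ q))) (pq≈0 0))
  go (b ∷ q) pq≈0 (suc i) =
    go q (λ j → trans (sym (coeff-*-shift (a ∷ p) (b ∷ q) (go (b ∷ q) pq≈0 zero) j))
                      (pq≈0 (suc j))) i

*ₚ-nonZero : ∀ p q → NonZeroₚ p → NonZeroₚ q → NonZeroₚ (p *ₚ q)
*ₚ-nonZero p q p≢0 q≢0 pq≈0 = q≢0 (*ₚ-cancel p q p≢0 pq≈0)

------------------------------------------------------------------------
-- ℚ(x), the field of fractions of ℚ[x]

record Fraction : Set where
  constructor fraction
  field
    num     : Poly
    den     : Poly
    nonZero : NonZeroₚ den

open Fraction

1≢0 : NonZeroₚ (const 1ℚ)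
1≢0 1≈0 = contradiction (1≈0 0) λ ()

⟦_⟧ : Poly → Fraction
⟦ p ⟧ = fraction p (const 1ℚ) 1≢0

ℚ⟨x⟩ : RawRing 0ℓ 0ℓ
ℚ⟨x⟩ = record
  { Carrier = Fraction
  ; _≈_     = λ u v → num u *ₚ den v ≈ₚ num v *ₚ den u
  ; _+_     = λ u v → fraction (num u *ₚ den v +ₚ num v *ₚ den u) (den u *ₚ den v)
                               (*ₚ-nonZero (den u) (den v) (nonZero u) (nonZero v))
  ; _*_     = λ u v → fraction (num u *ₚ num v) (den u *ₚ den v)
                               (*ₚ-nonZero (den u) (den v) (nonZero u) (nonZero v))
  ; -_      = λ u → fraction (-ₚ num u) (den u) (nonZero u)
  ; 0#      = ⟦ [] ⟧
  ; 1#      = ⟦ const 1ℚ ⟧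
  }

X/[1+X] : Fraction
X/[1+X] = fraction X (const 1ℚ +ₚ X) λ 1+X≈0 → contradiction (1+X≈0 0) λ ()

{-# OPTIONS --safe #-}

-- Let H(x,y) be the sum of xᵏyⁿ⁻¹⁻ᵏ over 𝔖 n, where k is the number of
-- alternating runs.  Inserting a new maximum into a permutation with
-- k runs gives k permutations with k runs, two with k + 1 and n − 1 − k
-- with k + 2, so passing from n to n + 1 applies the linear operator
-- f ↦ xy ∂f/∂x + 2xf + x² ∂f/∂y to H.
--
-- Splitting a word at its minimum identifies augmented André
-- permutations with increasing 1–2 trees; a tree with k leaves has
-- k − 1 left peaks.  A new maximum can be attached to each of the k
-- leaves (keeping k) or to each of the n − 2k + 1 unary nodes (giving
-- k + 1).  In terms of z = x + y the operator above maps xᵏzⁿ⁻¹⁻ᵏ to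
-- k xᵏzⁿ⁻ᵏ + (n − 2k + 1) xᵏ⁺¹zⁿ⁻ᵏ⁻¹, which is the same recurrence.
-- Hence H(x,y) is twice the sum of xᵏ(x + y)ⁿ⁻¹⁻ᵏ over 𝔄 n, and the
-- two identities are the cases x + y = 1 and y = 1.
--
-- To avoid derivatives, a linear functional on homogeneous polynomials
-- is given by its values on the monomials, and the operator acts on
-- these functionals.
module Submission where

open import Algebra.Bundles using (CommutativeRing)
open import Algebra.Bundles.Raw using (module RawRing)
open import Data.Bool.Base using (Bool; true; false; not; _∧_; _∨_; if_then_else_)
open import Data.Fin.Base using (Fin; toℕ; fromℕ<)
import Data.Fin.Properties as Fin
open import Data.List.Base
  using (List; []; _∷_; [_]; _++_; _∷ʳ_; map; foldr; filter; concatMap; length; applyUpTo; applyDownFrom; initLast; _∷ʳ′_)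
import Data.List.Properties as List
open import Data.List.Membership.Propositional using (_∈_)
open import Data.List.Membership.Propositional.Properties
open import Data.List.Membership.Propositional.Properties.WithK using (unique∧set⇒bag)
open import Data.List.Relation.Binary.BagAndSetEquality using (∼bag⇒↭)
open import Data.List.Relation.Binary.Disjoint.Propositional using (Disjoint)
open import Data.List.Relation.Binary.Permutation.Propositional as ↭ using (_↭_; ↭-sym; ↭-trans; prep; ↭⇒↭ₛ)
open import Data.List.Relation.Binary.Permutation.Propositional.Properties as ↭ₚ
  using (All-resp-↭; ∈-resp-↭; ↭-length; ↭-singleton-inv; shift; drop-mid; drop-∷)
import Data.List.Relation.Binary.Permutation.Setoid.Properties as ↭ₛ
open import Data.List.Relation.Unary.All as All using (All; []; _∷_)
import Data.List.Relation.Unary.All.Properties as All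
open import Data.List.Relation.Unary.AllPairs using ([]; _∷_)
open import Data.List.Relation.Unary.Any as Any using (Any; here; there)
import Data.List.Relation.Unary.Any.Properties as Any
open import Data.List.Relation.Unary.Unique.Propositional using (Unique)
import Data.List.Relation.Unary.Unique.Propositional.Properties as Unique
open import Data.Maybe.Base using (Maybe; just; nothing; maybe)
open import Data.Maybe.Properties using (just-injective)
open import Data.Nat.Base as ℕ using (ℕ; zero; suc; pred; _≤_; _<_; _<ᵇ_; z≤n; s≤s; _∸_; _⊔_; _⊓_)
import Data.Nat.Properties as ℕ
open import Data.Product.Base using (∃; _×_; _,_; proj₁; proj₂)
open import Data.Rational.Base as ℚ using (ℚ; 0ℚ; 1ℚ; ½)
import Data.Rational.Properties as ℚ
import Data.Rational.Solver as ℚ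
open import Data.Sum.Base using (_⊎_; inj₁; inj₂)
open import Data.Vec.Base using (Vec; []; _∷_)
import Data.Vec.Relation.Unary.All as VecAll
import Data.Vec.Relation.Unary.AllPairs as VecAllPairs
import Data.Vec.Relation.Unary.Unique.Propositional as Vec
open import Function.Base using (_∘_; id)
open import Function.Bundles using (mk⇔)
open import Level using (0ℓ)
open import Relation.Binary.Definitions using (tri<; tri≈; tri>)
open import Relation.Binary.PropositionalEquality as ≡
  using (_≡_; _≢_; refl; sym; trans; cong; cong₂; subst; subst₂)
open import Relation.Nullary using (¬_; does; yes; no; contradiction; ¬?)
open import Relation.Nullary.Decidable using (dec-true; dec-false; _⊎-dec_)
open import Relation.Unary using (Decidable)
open import Defs

-- Increasing 1–2 trees

-- The functional stays arbitrary throughout the induction: passing from n to n + 1 replaces g by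
-- `promote g` on both sides, so permutations and trees are compared for all g at once, and powers
-- of two ring elements x and y are substituted only at the end. The ring is left general because
-- the two identities live in different rings, ℚ[x] and ℚ(x). Neither `𝔖 n` nor `𝔄 n` is built by
-- adding a maximum; both are filtered out of all words. Each is therefore matched with a
-- recursively generated list, by showing that the two lists have the same members and no
-- repetitions. On the André side the delicate direction is to recover the tree: the recursion into
-- the part left of the minimum requires the last letter of that part to be its maximum, and it is
-- condition (2), applied to the step down into the minimum, that forces this.

data Tree : Set where
  leaf : ℕ → Tree
  one  : ℕ → Tree → Tree
  two  : Tree → ℕ → Tree → Tree

leaves : Tree → ℕ
leaves (leaf m)    = 1
leaves (one m v)   = leaves v
leaves (two u m v) = leaves u ℕ.+ leaves v

unary : Tree → ℕ
unary (leaf m)    = 0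
unary (one m v)   = suc (unary v)
unary (two u m v) = unary u ℕ.+ unary v

inner : Tree → ℕ
inner (leaf m)    = 0
inner (one m v)   = suc (inner v)
inner (two u m v) = suc (inner u ℕ.+ inner v)

-- The new maximum M becomes a child of a leaf or of a unary node.  At
-- every node the subtree containing the maximum is kept on the right,
-- so the two subtrees of a node may have to be exchanged.
grow : ℕ → Tree → List Tree
grow M (leaf m)    = [ one m (leaf M) ]
grow M (one m v)   = two v m (leaf M) ∷ map (one m) (grow M v)
grow M (two u m v) = map (two u m) (grow M v) ++ map (two v m) (grow M u)

trees : ℕ → List Tree
trees zero          = []
trees (suc zero)    = [ leaf 1 ]
trees (suc (suc n)) = concatMap (grow (suc (suc n))) (trees (suc n))

-- There is one more leaf than there are binary nodes, and the inner nodes are the unary and the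
-- binary ones. Together with `leaves+inner` this yields the count n - 2k + 1 of unary nodes.
leaves+unary : ∀ t → leaves t ℕ.+ unary t ≡ suc (inner t)
leaves+unary (leaf m)    = refl
leaves+unary (one m v)   = trans (ℕ.+-suc _ _) (cong suc (leaves+unary v))
leaves+unary (two u m v) = begin
  (leaves u ℕ.+ leaves v) ℕ.+ (unary u ℕ.+ unary v)  ≡⟨ interchange (leaves u) _ _ _ ⟩
  (leaves u ℕ.+ unary u) ℕ.+ (leaves v ℕ.+ unary v)  ≡⟨ cong₂ ℕ._+_ (leaves+unary u) (leaves+unary v) ⟩
  suc (inner u) ℕ.+ suc (inner v)                    ≡⟨ cong suc (ℕ.+-suc (inner u) (inner v)) ⟩
  suc (suc (inner u ℕ.+ inner v))                    ∎
  where
  open ≡.≡-Reasoning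
  open import Algebra.Properties.CommutativeSemigroup ℕ.+-commutativeSemigroup using (interchange)

-- Weights of permutations and trees

-- Up–down signatures (true for an ascent).  changes and repeats count
-- the adjacent unequal and equal entries of p ∷ s.
changes repeats : Bool → List Bool → ℕ
changes p     []          = 0
changes true  (true ∷ s)  = changes true s
changes true  (false ∷ s) = suc (changes false s)
changes false (true ∷ s)  = suc (changes true s)
changes false (false ∷ s) = changes false s
repeats p     []          = 0
repeats true  (true ∷ s)  = suc (repeats true s)
repeats true  (false ∷ s) = repeats false s
repeats false (true ∷ s)  = repeats true s
repeats false (false ∷ s) = suc (repeats false s)

-- The effect on the signature of inserting a new maximum anywhere
-- except in front of the word: a step is replaced by up–down, or an
-- up-step is appended.
signatures : List Bool → List (List Bool)
signatures []      = [ true ∷ [] ]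
signatures (q ∷ s) = (true ∷ false ∷ s) ∷ map (q ∷_) (signatures s)

module Weights (K : CommutativeRing 0ℓ 0ℓ) where
  open CommutativeRing K renaming (refl to ≈-refl; sym to ≈-sym; trans to ≈-trans) hiding (_-_)
  open InRing rawRing public using (_·_; _^_)
  open import Algebra.Solver.Ring.NaturalCoefficients.Default commutativeSemiring
    using (solve; _:=_; _:+_; _:*_; con)
  open import Relation.Binary.Reasoning.Setoid setoid

  sum : ∀ {A : Set} → List A → (A → Carrier) → Carrier
  sum xs f = foldr _+_ 0# (map f xs)

  ι : ℕ → Carrier
  ι n = n · 1#

  ι-+ : ∀ m n → ι (m ℕ.+ n) ≈ ι m + ι n
  ι-+ zero    n = ≈-sym (+-identityˡ _)
  ι-+ (suc m) n = ≈-trans (+-congˡ (ι-+ m n)) (≈-sym (+-assoc _ _ _))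

  sum-map : ∀ {A B : Set} (f : A → B) xs g → sum (map f xs) g ≈ sum xs (g ∘ f)
  sum-map f xs g = reflexive (cong (foldr _+_ 0#) (sym (List.map-∘ xs)))

  sum-++ : ∀ {A : Set} (xs ys : List A) f → sum (xs ++ ys) f ≈ sum xs f + sum ys f
  sum-++ []       ys f = ≈-sym (+-identityˡ _)
  sum-++ (x ∷ xs) ys f = ≈-trans (+-congˡ (sum-++ xs ys f)) (≈-sym (+-assoc _ _ _))

  sum-concatMap : ∀ {A B : Set} (f : A → List B) xs g →
                  sum (concatMap f xs) g ≈ sum xs (λ x → sum (f x) g)
  sum-concatMap f []       g = ≈-refl
  sum-concatMap f (x ∷ xs) g = ≈-trans (sum-++ (f x) _ g) (+-congˡ (sum-concatMap f xs g))

  sum-cong : ∀ {A : Set} {f g : A → Carrier} xs → All (λ x → f x ≈ g x) xs → sum xs f ≈ sum xs g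
  sum-cong []       []         = ≈-refl
  sum-cong (x ∷ xs) (eq ∷ eqs) = +-cong eq (sum-cong xs eqs)

  sum-↭ : ∀ {A : Set} {xs ys : List A} (f : A → Carrier) → xs ↭ ys → sum xs f ≈ sum ys f
  sum-↭ f ↭.refl         = ≈-refl
  sum-↭ f (↭.prep x p)   = +-congˡ (sum-↭ f p)
  sum-↭ f (↭.swap x y p) =
    ≈-trans (+-congˡ (+-congˡ (sum-↭ f p)))
          (solve 3 (λ a b c → a :+ (b :+ c) := b :+ (a :+ c)) ≈-refl _ _ _)
  sum-↭ f (↭.trans p q)  = ≈-trans (sum-↭ f p) (sum-↭ f q)

  sum-*ˡ : ∀ {A : Set} a (xs : List A) f → a * sum xs f ≈ sum xs (λ x → a * f x)
  sum-*ˡ a []       f = zeroʳ a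
  sum-*ˡ a (x ∷ xs) f = ≈-trans (distribˡ a _ _) (+-congˡ (sum-*ˡ a xs f))

  Weight : Set
  Weight = ℕ → ℕ → Carrier

  -- g i j is the value of a linear functional at xⁱyʲ, and promote
  -- composes it with the operator f ↦ xy ∂f/∂x + 2xf + x² ∂f/∂y.
  promote : Weight → Weight
  promote g i j = ι i * g i (suc j) + ι 2 * g (suc i) j + ι j * g (suc (suc i)) (pred j)

  -- Insertion of a maximum into a signature

  sum-signatures : ∀ q s f → sum (signatures (q ∷ s)) f ≈
                   f (true ∷ false ∷ s) + sum (signatures s) (f ∘ (q ∷_))
  sum-signatures q s f = +-congˡ (sum-map (q ∷_) (signatures s) f)

  weight : Bool → Weight → List Bool → Carrier
  weight p g s = g (changes p s) (repeats p s)

  -- Shifting the second argument of g turns `pred e` into `suc (pred e)`. At e = 0 the discrepancy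
  -- is harmless because the coefficient vanishes.
  pred-cancel : ∀ e (h : ℕ → Carrier) → ι e * h (suc (pred e)) ≈ ι e * h e
  pred-cancel zero    h = ≈-trans (zeroˡ _) (≈-sym (zeroˡ _))
  pred-cancel (suc e) h = ≈-refl

  private
    -- What remains of the operator, at a signature with c changes and e repeats, once the
    -- insertions in front of the word and between its first two letters are set aside. When the
    -- word does not begin with two ascents, these contribute one `g c (suc e)` and one
    -- `g (suc c) e`, so the coefficients c + 1 and 2 drop to c and 1.
    expand : Weight → Weight
    expand g c e = ι c * g c (suc e) + g (suc c) e + ι e * g (suc (suc c)) (pred e)

  mutual
    -- These are the insertions behind the second letter of a word whose first step is a descent.
    -- Splitting off the first step of s adds a repeat or a change to all the signatures that
    -- follow; this is absorbed by shifting an argument of g, so g has to vary in the recursion.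
    after-false : ∀ g s → sum (signatures s) (weight false g) ≈
                  expand g (changes false s) (repeats false s)
    after-false g [] =
      solve 3 (λ a b c → b :+ con 0 := con 0 :* a :+ b :+ con 0 :* c) ≈-refl _ _ _
    after-false g (false ∷ s) = begin
      sum (signatures (false ∷ s)) (weight false g)
        ≈⟨ sum-signatures false s _ ⟩
      g (2 ℕ.+ c) e + sum (signatures s) (weight false λ i j → g i (suc j))
        ≈⟨ +-congˡ (after-false (λ i j → g i (suc j)) s) ⟩
      g (2 ℕ.+ c) e + (ι c * g c (2 ℕ.+ e) + g (suc c) (suc e) + ι e * g (2 ℕ.+ c) (suc (pred e)))
        ≈⟨ +-congˡ (+-congˡ (pred-cancel e (g (2 ℕ.+ c)))) ⟩
      g (2 ℕ.+ c) e + (ι c * g c (2 ℕ.+ e) + g (suc c) (suc e) + ι e * g (2 ℕ.+ c) e)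
        ≈⟨ solve 4 (λ a b d e → a :+ (b :+ d :+ e :* a) := b :+ d :+ (con 1 :+ e) :* a) ≈-refl _ _ _ _ ⟩
      expand g c (suc e) ∎
      where c = changes false s
            e = repeats false s
    after-false g (true ∷ []) =
      solve 3 (λ a b z → a :+ (b :+ con 0) := (con 1 :+ con 0) :* b :+ a :+ con 0 :* z) ≈-refl _ _ _
    after-false g (true ∷ true ∷ s) = begin
      sum (signatures (true ∷ true ∷ s)) (weight false g)
        ≈⟨ sum-signatures true (true ∷ s) _ ⟩
      g (3 ℕ.+ c) e + sum (signatures (true ∷ s)) (weight true λ i → g (suc i))
        ≈⟨ +-congˡ (after-true-up (λ i → g (suc i)) s) ⟩
      g (3 ℕ.+ c) e + (ι (suc c) * g (suc c) (2 ℕ.+ e) + g (2 ℕ.+ c) (suc e) + ι e * g (3 ℕ.+ c) e)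
        ≈⟨ solve 4 (λ a b d e → a :+ (b :+ d :+ e :* a) := b :+ d :+ (con 1 :+ e) :* a) ≈-refl _ _ _ _ ⟩
      expand g (suc c) (suc e) ∎
      where c = changes true s
            e = repeats true s
    after-false g (true ∷ false ∷ s) = begin
      sum (signatures (true ∷ false ∷ s)) (weight false g)
        ≈⟨ sum-signatures true (false ∷ s) _ ⟩
      g (2 ℕ.+ c) (suc e) + sum (signatures (false ∷ s)) (weight true λ i → g (suc i))
        ≈⟨ +-congˡ (after-true-down (λ i → g (suc i)) s) ⟩
      g (2 ℕ.+ c) (suc e) + expand (λ i → g (suc i)) (suc c) e
        ≈⟨ solve 4 (λ a c d f → a :+ ((con 1 :+ c) :* a :+ d :+ f) := (con 1 :+ (con 1 :+ c)) :* a :+ d :+ f) ≈-refl _ _ _ _ ⟩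
      expand g (2 ℕ.+ c) e ∎
      where c = changes false s
            e = repeats false s

    after-true-down : ∀ g s → sum (signatures (false ∷ s)) (weight true g) ≈
                      expand g (suc (changes false s)) (repeats false s)
    after-true-down g s = begin
      sum (signatures (false ∷ s)) (weight true g)
        ≈⟨ sum-signatures false s _ ⟩
      g (suc c) (suc e) + sum (signatures s) (weight false λ i → g (suc i))
        ≈⟨ +-congˡ (after-false (λ i → g (suc i)) s) ⟩
      g (suc c) (suc e) + expand (λ i → g (suc i)) c e
        ≈⟨ solve 4 (λ a c d f → a :+ (c :* a :+ d :+ f) := (con 1 :+ c) :* a :+ d :+ f) ≈-refl _ _ _ _ ⟩
      expand g (suc c) e ∎
      where c = changes false s
            e = repeats false s

    -- After two ascents the balance differs: the word has c changes and e + 1 repeats, and the two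
    -- insertions set aside contribute `g (suc c) (suc e)` and `g (2 + c) e`. They reduce the second
    -- and third coefficients of the operator instead of the first and second.
    after-true-up : ∀ g s → let c = changes true s; e = repeats true s in
                    sum (signatures (true ∷ s)) (weight true g) ≈
                    ι (suc c) * g c (2 ℕ.+ e) + g (suc c) (suc e) + ι e * g (2 ℕ.+ c) e
    after-true-up g [] =
      solve 3 (λ a b z → a :+ (b :+ con 0) := (con 1 :+ con 0) :* b :+ a :+ con 0 :* z) ≈-refl _ _ _
    after-true-up g (true ∷ s) = begin
      sum (signatures (true ∷ true ∷ s)) (weight true g)
        ≈⟨ sum-signatures true (true ∷ s) _ ⟩
      g (2 ℕ.+ c) (suc e) + sum (signatures (true ∷ s)) (weight true λ i j → g i (suc j))
        ≈⟨ +-congˡ (after-true-up (λ i j → g i (suc j)) s) ⟩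
      g (2 ℕ.+ c) (suc e) + (ι (suc c) * g c (3 ℕ.+ e) + g (suc c) (2 ℕ.+ e) + ι e * g (2 ℕ.+ c) (suc e))
        ≈⟨ solve 4 (λ a b d e → a :+ (b :+ d :+ e :* a) := b :+ d :+ (con 1 :+ e) :* a) ≈-refl _ _ _ _ ⟩
      ι (suc c) * g c (3 ℕ.+ e) + g (suc c) (2 ℕ.+ e) + ι (suc e) * g (2 ℕ.+ c) (suc e) ∎
      where c = changes true s
            e = repeats true s
    after-true-up g (false ∷ s) = begin
      sum (signatures (true ∷ false ∷ s)) (weight true g)
        ≈⟨ sum-signatures true (false ∷ s) _ ⟩
      g (suc c) (2 ℕ.+ e) + sum (signatures (false ∷ s)) (weight true λ i j → g i (suc j))
        ≈⟨ +-congˡ (after-true-down (λ i j → g i (suc j)) s) ⟩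
      g (suc c) (2 ℕ.+ e) + (ι (suc c) * g (suc c) (2 ℕ.+ e) + g (2 ℕ.+ c) (suc e) + ι e * g (3 ℕ.+ c) (suc (pred e)))
        ≈⟨ +-congˡ (+-congˡ (pred-cancel e (g (3 ℕ.+ c)))) ⟩
      g (suc c) (2 ℕ.+ e) + (ι (suc c) * g (suc c) (2 ℕ.+ e) + g (2 ℕ.+ c) (suc e) + ι e * g (3 ℕ.+ c) e)
        ≈⟨ solve 4 (λ a c d f → a :+ (c :* a :+ d :+ f) := (con 1 :+ c) :* a :+ d :+ f) ≈-refl _ _ _ _ ⟩
      ι (2 ℕ.+ c) * g (suc c) (2 ℕ.+ e) + g (2 ℕ.+ c) (suc e) + ι e * g (3 ℕ.+ c) e ∎
      where c = changes false s
            e = repeats false s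

  -- 1 + changes is the number of alternating runs.
  runWeight : Weight → List Bool → Carrier
  runWeight g []      = 0#
  runWeight g (p ∷ s) = g (suc (changes p s)) (repeats p s)

  -- The insertion in front prepends a descent, and the head of `signatures` is the insertion
  -- between the first two letters. Adding these two back to the sums above restores the full
  -- coefficients; the shift `λ i → g (suc i)` passes from changes to runs.
  sum-insertMax : ∀ g p s → sum ((false ∷ p ∷ s) ∷ signatures (p ∷ s)) (runWeight g) ≈
                  runWeight (promote g) (p ∷ s)
  sum-insertMax g false s = begin
    g (suc c) (suc e) + sum (signatures (false ∷ s)) (runWeight g)
      ≈⟨ +-congˡ (sum-signatures false s _) ⟩
    g (suc c) (suc e) + (g (2 ℕ.+ c) e + sum (signatures s) (weight false λ i → g (suc i)))
      ≈⟨ +-congˡ (+-congˡ (after-false (λ i → g (suc i)) s)) ⟩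
    g (suc c) (suc e) + (g (2 ℕ.+ c) e + expand (λ i → g (suc i)) c e)
      ≈⟨ solve 4 (λ a b c d → a :+ (b :+ (c :* a :+ b :+ d)) :=
            (con 1 :+ c) :* a :+ (con 1 :+ (con 1 :+ con 0)) :* b :+ d) ≈-refl _ _ _ _ ⟩
    promote g (suc c) e ∎
    where c = changes false s
          e = repeats false s
  sum-insertMax g true [] =
    solve 3 (λ a b d → b :+ (b :+ (a :+ con 0)) :=
      (con 1 :+ con 0) :* a :+ (con 1 :+ (con 1 :+ con 0)) :* b :+ con 0 :* d) ≈-refl _ _ _
  sum-insertMax g true (true ∷ s) = begin
    g (2 ℕ.+ c) (suc e) + sum (signatures (true ∷ true ∷ s)) (runWeight g)
      ≈⟨ +-congˡ (sum-signatures true (true ∷ s) _) ⟩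
    g (2 ℕ.+ c) (suc e) + (g (3 ℕ.+ c) e + sum (signatures (true ∷ s)) (weight true λ i → g (suc i)))
      ≈⟨ +-congˡ (+-congˡ (after-true-up (λ i → g (suc i)) s)) ⟩
    g (2 ℕ.+ c) (suc e) + (g (3 ℕ.+ c) e +
      (ι (suc c) * g (suc c) (2 ℕ.+ e) + g (2 ℕ.+ c) (suc e) + ι e * g (3 ℕ.+ c) e))
      ≈⟨ solve 4 (λ a b c e → a :+ (b :+ (c :+ a :+ e :* b)) :=
            c :+ (con 1 :+ (con 1 :+ con 0)) :* a :+ (con 1 :+ e) :* b) ≈-refl _ _ _ _ ⟩
    promote g (suc c) (suc e) ∎
    where c = changes true s
          e = repeats true s
  sum-insertMax g true (false ∷ s) = begin
    g (3 ℕ.+ c) e + sum (signatures (true ∷ false ∷ s)) (runWeight g)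
      ≈⟨ +-congˡ (sum-signatures true (false ∷ s) _) ⟩
    g (3 ℕ.+ c) e + (g (2 ℕ.+ c) (suc e) + sum (signatures (false ∷ s)) (weight true λ i → g (suc i)))
      ≈⟨ +-congˡ (+-congˡ (after-true-down (λ i → g (suc i)) s)) ⟩
    g (3 ℕ.+ c) e + (g (2 ℕ.+ c) (suc e) + expand (λ i → g (suc i)) (suc c) e)
      ≈⟨ solve 4 (λ a b c d → a :+ (b :+ ((con 1 :+ c) :* b :+ a :+ d)) :=
            (con 1 :+ (con 1 :+ c)) :* b :+ (con 1 :+ (con 1 :+ con 0)) :* a :+ d) ≈-refl _ _ _ _ ⟩
    promote g (2 ℕ.+ c) e ∎
    where c = changes false s
          e = repeats false s

  -- The functional g at xᵏyʲ(x + y)ᴺ.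
  evaluate : ℕ → Weight → Weight
  evaluate zero    g k j = g k j
  evaluate (suc N) g k j = evaluate N g (suc k) j + evaluate N g k (suc j)

  -- The derivation xy ∂/∂x + x² ∂/∂y sends z = x + y to xy + x² = xz. Hence the factor zᴺ
  -- contributes N x, which joins the summand 2x of the operator to give the coefficient 2 + N.
  evaluate-promote : ∀ N g k j → evaluate N (promote g) k j ≈
    ι k * evaluate N g k (suc j) + ι (2 ℕ.+ N) * evaluate N g (suc k) j +
    ι j * evaluate N g (suc (suc k)) (pred j)
  evaluate-promote zero    g k j = ≈-refl
  evaluate-promote (suc N) g k j = begin
    evaluate N (promote g) (suc k) j + evaluate N (promote g) k (suc j)
      ≈⟨ +-cong (evaluate-promote N g (suc k) j) (evaluate-promote N g k (suc j)) ⟩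
    (ι (suc k) * E (suc k) (suc j) + ι (2 ℕ.+ N) * E (2 ℕ.+ k) j + ι j * E (3 ℕ.+ k) (pred j)) +
    (ι k * E k (2 ℕ.+ j) + ι (2 ℕ.+ N) * E (suc k) (suc j) + ι (suc j) * E (2 ℕ.+ k) j)
      ≈⟨ solve 7 (λ k N j a b c d →
           ((con 1 :+ k) :* a :+ N :* b :+ c) :+ (k :* d :+ N :* a :+ (con 1 :+ j) :* b) :=
           k :* (a :+ d) :+ (con 1 :+ N) :* (b :+ a) :+ (c :+ j :* b)) ≈-refl
           (ι k) (ι (2 ℕ.+ N)) (ι j) _ _ _ _ ⟩
    ι k * (E (suc k) (suc j) + E k (2 ℕ.+ j)) + ι (3 ℕ.+ N) * (E (2 ℕ.+ k) j + E (suc k) (suc j)) +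
    (ι j * E (3 ℕ.+ k) (pred j) + ι j * E (2 ℕ.+ k) j)
      ≈⟨ +-congˡ (≈-trans (+-congˡ (≈-sym (pred-cancel j (E (2 ℕ.+ k))))) (≈-sym (distribˡ _ _ _))) ⟩
    ι k * evaluate (suc N) g k (suc j) + ι (3 ℕ.+ N) * evaluate (suc N) g (suc k) j +
    ι j * evaluate (suc N) g (suc (suc k)) (pred j) ∎
    where E = evaluate N g

  -- The function h is arbitrary so that the counts of the root and of an untouched sibling subtree
  -- can be absorbed into it when growth happens in the other subtree.
  sum-grow : ∀ M t (h : Weight) → sum (grow M t) (λ t′ → h (leaves t′) (inner t′)) ≈
             ι (leaves t) * h (leaves t) (suc (inner t)) + ι (unary t) * h (suc (leaves t)) (inner t)
  sum-grow M (leaf m) h =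
    solve 2 (λ a b → a :+ con 0 := (con 1 :+ con 0) :* a :+ con 0 :* b) ≈-refl _ _
  sum-grow M (one m v) h = begin
    h (leaves v ℕ.+ 1) (suc (inner v ℕ.+ 0)) + sum (map (one m) (grow M v)) _
      ≈⟨ +-cong (reflexive (cong₂ h (ℕ.+-comm (leaves v) 1) (cong suc (ℕ.+-identityʳ _))))
                (≈-trans (sum-map (one m) (grow M v) _) (sum-grow M v λ i j → h i (suc j))) ⟩
    h (suc (leaves v)) (suc (inner v)) + (ι (leaves v) * h (leaves v) (2 ℕ.+ inner v) +
      ι (unary v) * h (suc (leaves v)) (suc (inner v)))
      ≈⟨ solve 3 (λ a b d → a :+ (b :+ d :* a) := b :+ (con 1 :+ d) :* a) ≈-refl _ _ _ ⟩
    ι (leaves v) * h (leaves v) (2 ℕ.+ inner v) + ι (suc (unary v)) * h (suc (leaves v)) (suc (inner v)) ∎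
  sum-grow M (two u m v) h = begin
    sum (map (two u m) (grow M v) ++ map (two v m) (grow M u)) H
      ≈⟨ ≈-trans (sum-++ (map (two u m) (grow M v)) _ H)
               (+-cong (sum-map (two u m) (grow M v) H) (sum-map (two v m) (grow M u) H)) ⟩
    sum (grow M v) (λ t′ → h (leaves u ℕ.+ leaves t′) (suc (inner u ℕ.+ inner t′))) +
    sum (grow M u) (λ t′ → h (leaves v ℕ.+ leaves t′) (suc (inner v ℕ.+ inner t′)))
      ≈⟨ +-cong (sum-grow M v λ i j → h (leaves u ℕ.+ i) (suc (inner u ℕ.+ j)))
                (sum-grow M u λ i j → h (leaves v ℕ.+ i) (suc (inner v ℕ.+ j))) ⟩
    (ι (leaves v) * h (leaves u ℕ.+ leaves v) (suc (inner u ℕ.+ suc (inner v))) +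
     ι (unary v) * h (leaves u ℕ.+ suc (leaves v)) (suc (inner u ℕ.+ inner v))) +
    (ι (leaves u) * h (leaves v ℕ.+ leaves u) (suc (inner v ℕ.+ suc (inner u))) +
     ι (unary u) * h (leaves v ℕ.+ suc (leaves u)) (suc (inner v ℕ.+ inner u)))
      ≈⟨ +-cong
           (+-cong (*-congˡ (reflexive (cong (h _) (cong suc (ℕ.+-suc (inner u) (inner v))))))
                   (*-congˡ (reflexive (cong (λ i → h i (suc (inner u ℕ.+ inner v))) (ℕ.+-suc (leaves u) (leaves v))))))
           (+-cong (*-congˡ (reflexive (cong₂ h (ℕ.+-comm (leaves v) (leaves u))
                      (cong suc (trans (ℕ.+-suc (inner v) (inner u)) (cong suc (ℕ.+-comm (inner v) (inner u))))))))
                   (*-congˡ (reflexive (cong₂ h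
                      (trans (ℕ.+-suc (leaves v) (leaves u)) (cong suc (ℕ.+-comm (leaves v) (leaves u))))
                      (cong suc (ℕ.+-comm (inner v) (inner u))))))) ⟩
    (ι (leaves v) * A + ι (unary v) * B) + (ι (leaves u) * A + ι (unary u) * B)
      ≈⟨ solve 6 (λ lv nv lu nu a b → (lv :* a :+ nv :* b) :+ (lu :* a :+ nu :* b) :=
                    (lu :+ lv) :* a :+ (nu :+ nv) :* b) ≈-refl _ _ _ _ _ _ ⟩
    (ι (leaves u) + ι (leaves v)) * A + (ι (unary u) + ι (unary v)) * B
      ≈⟨ +-cong (*-congʳ (≈-sym (ι-+ (leaves u) _))) (*-congʳ (≈-sym (ι-+ (unary u) _))) ⟩
    ι (leaves u ℕ.+ leaves v) * A + ι (unary u ℕ.+ unary v) * B ∎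
    where
    H : Tree → Carrier
    H t′ = h (leaves t′) (inner t′)
    A = h (leaves u ℕ.+ leaves v) (suc (suc (inner u ℕ.+ inner v)))
    B = h (suc (leaves u ℕ.+ leaves v)) (suc (inner u ℕ.+ inner v))

  -- A tree with k leaves and i inner nodes stands for xᵏ(x + y)ⁱ⁻¹; the
  -- junk value at i = 0 concerns only the one-node tree.
  treeWeight : Weight → Weight
  treeWeight g k zero    = 0#
  treeWeight g k (suc N) = evaluate N g k 0

  -- Growth at the k leaves raises the exponent of x + y by one; expanding that extra factor gives k
  -- copies each of `E (suc k) 0` and `E k 1`. The former merge with the contribution of the unary
  -- nodes, and `leaves+unary` makes their joint coefficient 2 + N, as `evaluate-promote` demands.
  sum-grow-treeWeight : ∀ M t N g → inner t ≡ suc N →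
    sum (grow M t) (λ t′ → treeWeight g (leaves t′) (inner t′)) ≈
    treeWeight (promote g) (leaves t) (inner t)
  sum-grow-treeWeight M t N g eq = begin
    sum (grow M t) (λ t′ → treeWeight g (leaves t′) (inner t′))
      ≈⟨ sum-grow M t (treeWeight g) ⟩
    ι k * treeWeight g k (suc (inner t)) + ι (unary t) * treeWeight g (suc k) (inner t)
      ≈⟨ reflexive (cong (λ i → ι k * treeWeight g k (suc i) + ι (unary t) * treeWeight g (suc k) i) eq) ⟩
    ι k * (E (suc k) 0 + E k 1) + ι (unary t) * E (suc k) 0
      -- The vanishing third summand is put in to match `evaluate-promote` at j = 0.
      ≈⟨ solve 5 (λ k u a b c → k :* (a :+ b) :+ u :* a := k :* b :+ (k :+ u) :* a :+ con 0 :* c)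
               ≈-refl (ι k) (ι (unary t)) (E (suc k) 0) (E k 1) (E (2 ℕ.+ k) 0) ⟩
    ι k * E k 1 + (ι k + ι (unary t)) * E (suc k) 0 + 0# * E (2 ℕ.+ k) 0
      ≈⟨ +-congʳ (+-congˡ (*-congʳ (≈-trans (≈-sym (ι-+ k _))
           (reflexive (cong ι (trans (leaves+unary t) (cong suc eq))))))) ⟩
    ι k * E k 1 + ι (2 ℕ.+ N) * E (suc k) 0 + 0# * E (2 ℕ.+ k) 0
      ≈⟨ evaluate-promote N g k 0 ⟨
    evaluate N (promote g) k 0
      ≈⟨ reflexive (cong (treeWeight (promote g) k) eq) ⟨
    treeWeight (promote g) k (inner t) ∎
    where
    k = leaves t
    E = evaluate N g

-- Trees as words

Unique-resp-↭ : ∀ {A : Set} {xs ys : List A} → xs ↭ ys → Unique xs → Unique ys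
Unique-resp-↭ {A} p = ↭ₛ.Unique-resp-↭ (≡.setoid A) (↭⇒↭ₛ p)

unique-↭ : ∀ {A : Set} {xs ys : List A} → Unique xs → Unique ys →
           (∀ {x} → x ∈ xs → x ∈ ys) → (∀ {x} → x ∈ ys → x ∈ xs) → xs ↭ ys
unique-↭ xs! ys! to from = ∼bag⇒↭ (unique∧set⇒bag xs! ys! (mk⇔ to from))

-- The partial map g recovers x from any element of `f x`, so the blocks of different x are
-- disjoint. It is the deletion of the maximum in both applications.
concatMap-unique : ∀ {A B : Set} (f : A → List B) (g : B → Maybe A) {xs} → Unique xs →
                   All (λ x → Unique (f x) × All (λ y → g y ≡ just x) (f x)) xs →
                   Unique (concatMap f xs)
concatMap-unique f g []          []                 = []
concatMap-unique f g {x ∷ xs} (x∉ ∷ xs!) ((fx! , gfx) ∷ fs) =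
  Unique.++⁺ fx! (concatMap-unique f g xs! fs) disjoint
  where
  disjoint : Disjoint (f x) (concatMap f xs)
  disjoint {y} (y∈fx , y∈fxs) = go x∉ fs (∈-concatMap⁻ f y∈fxs)
    where
    go : ∀ {zs} → All (x ≢_) zs → All (λ x → Unique (f x) × All (λ y → g y ≡ just x) (f x)) zs →
         ¬ Any.Any (λ z → y ∈ f z) zs
    go (x≢z ∷ _) ((_ , gfz) ∷ _) (here y∈fz) =
      x≢z (just-injective (trans (sym (All.lookup gfx y∈fx)) (All.lookup gfz y∈fz)))
    go (_ ∷ x≢) (_ ∷ fs) (there p) = go x≢ fs p

-- Decreasing, so that `values (suc n)` unfolds to the new maximum followed by `values n`, the form
-- in which insertion and growth deliver it.
values : ℕ → List ℕ
values = applyDownFrom suc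

values≤ : ∀ n → All (_≤ n) (values n)
values≤ n = All.applyDownFrom⁺₁ suc n id

values< : ∀ n → All (_< suc n) (values n)
values< n = All.map s≤s (values≤ n)

values-unique : ∀ n → Unique (values n)
values-unique n = Unique.applyDownFrom⁺₁ suc n λ j<i _ eq → ℕ.<⇒≢ j<i (sym (ℕ.suc-injective eq))

word : Tree → List ℕ
word (leaf m)    = [ m ]
word (one m v)   = m ∷ word v
word (two u m v) = word u ++ m ∷ word v

top : Tree → ℕ
top (leaf m)    = m
top (one m v)   = top v
top (two u m v) = top v

initial : Tree → List ℕ
initial (leaf m)    = []
initial (one m v)   = m ∷ initial v
initial (two u m v) = word u ++ m ∷ initial v

-- The comparison of tops fixes the order of the two subtrees of a node. It also makes the last
-- letter of the word the maximum, which is the augmented condition π(n) = n.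
data Increasing : Tree → Set where
  leaf : ∀ {m} → Increasing (leaf m)
  one  : ∀ {m v} → All (m <_) (word v) → Increasing v → Increasing (one m v)
  two  : ∀ {u m v} → All (m <_) (word u) → All (m <_) (word v) → top u < top v →
         Increasing u → Increasing v → Increasing (two u m v)

word≡initial∷ʳtop : ∀ t → word t ≡ initial t ∷ʳ top t
word≡initial∷ʳtop (leaf m)    = refl
word≡initial∷ʳtop (one m v)   = cong (m ∷_) (word≡initial∷ʳtop v)
word≡initial∷ʳtop (two u m v) =
  trans (cong (λ w → word u ++ m ∷ w) (word≡initial∷ʳtop v)) (sym (List.++-assoc (word u) _ _))

∷ʳ-↭ : ∀ {A : Set} (xs : List A) x → xs ∷ʳ x ↭ x ∷ xs
∷ʳ-↭ xs x = ↭-trans (shift x xs []) (prep x (↭ₚ.++-identityʳ xs))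

word-↭ : ∀ t → word t ↭ top t ∷ initial t
word-↭ t = subst (_↭ top t ∷ initial t) (sym (word≡initial∷ʳtop t)) (∷ʳ-↭ (initial t) (top t))

top∈word : ∀ t → top t ∈ word t
top∈word t = ∈-resp-↭ (↭-sym (word-↭ t)) (here refl)

mutual
  initial<top : ∀ {t} → Increasing t → All (_< top t) (initial t)
  initial<top leaf = []
  initial<top (one {v = v} m<v inc) = All.lookup m<v (top∈word v) ∷ initial<top inc
  initial<top (two {u = u} {v = v} m<u m<v u<v incᵤ incᵥ) =
    All.++⁺ (All.map (λ x≤ → ℕ.≤-<-trans x≤ u<v) (word≤top incᵤ))
            (All.lookup m<v (top∈word v) ∷ initial<top incᵥ)

  word≤top : ∀ {t} → Increasing t → All (_≤ top t) (word t)
  word≤top {t} inc = All-resp-↭ (↭-sym (word-↭ t)) (ℕ.≤-refl ∷ All.map ℕ.<⇒≤ (initial<top inc))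

-- Reverses a possible exchange made by `grow`: once the maximum has left a subtree, its former
-- place on the right is no longer justified and the tops have to be compared again.
join : Tree → ℕ → Tree → Tree
join u m v = if top u <ᵇ top v then two u m v else two v m u

-- Deletes the maximum, undoing grow.
prune : Tree → Maybe Tree
prune (leaf m)    = nothing
prune (one m v)   = just (maybe (one m) (leaf m) (prune v))
prune (two u m v) = just (maybe (join u m) (one m u) (prune v))

join-< : ∀ {u m v} → top u < top v → join u m v ≡ two u m v
join-< {u} {m} {v} u<v rewrite dec-true (top u ℕ.<? top v) u<v = refl

join-> : ∀ {u m v} → top v < top u → join u m v ≡ two v m u
join-> {u} {m} {v} v<u rewrite dec-false (top u ℕ.<? top v) (ℕ.<-asym v<u) = refl

prune-grow : ∀ M {t} → Increasing t → All (λ t′ → prune t′ ≡ just t) (grow M t)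
prune-grow M leaf = refl ∷ []
prune-grow M (one {m} _ inc) =
  refl ∷ All.map⁺ (All.map (cong (just ∘ maybe (one m) (leaf m))) (prune-grow M inc))
prune-grow M (two {u} {m} {v} _ _ u<v incᵤ incᵥ) = All.++⁺
  (All.map⁺ (All.map (λ eq → trans (cong (just ∘ maybe (join u m) (one m u)) eq) (cong just (join-< u<v)))
                     (prune-grow M incᵥ)))
  (All.map⁺ (All.map (λ eq → trans (cong (just ∘ maybe (join v m) (one m v)) eq) (cong just (join-> {v} {m} {u} u<v)))
                     (prune-grow M incᵤ)))

grow-unique : ∀ M {t} → Increasing t → Unique (grow M t)
grow-unique M leaf = [] ∷ []
grow-unique M (one {m} {v} _ inc) =
  All.map⁺ (All.universal (λ _ ()) (grow M v)) ∷ Unique.map⁺ (λ { refl → refl }) (grow-unique M inc)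
grow-unique M (two {u} {m} {v} _ _ u<v incᵤ incᵥ) =
  Unique.++⁺ (Unique.map⁺ (λ { refl → refl }) (grow-unique M incᵥ))
             (Unique.map⁺ (λ { refl → refl }) (grow-unique M incᵤ))
             disjoint
  where
  disjoint : Disjoint (map (two u m) (grow M v)) (map (two v m) (grow M u))
  disjoint (p , q) with ∈-map⁻ (two u m) p | ∈-map⁻ (two v m) q
  ... | _ , _ , refl | _ , _ , refl = ℕ.<-irrefl refl u<v

Grown : ℕ → Tree → Tree → Set
Grown M t t′ = Increasing t′ × top t′ ≡ M × word t′ ↭ M ∷ word t

grow-sound : ∀ {M t} → Increasing t → All (_< M) (word t) → All (Grown M t) (grow M t)
grow-sound {M} (leaf {m}) (m<M ∷ []) = (one (m<M ∷ []) leaf , refl , ↭.swap m M ↭.refl) ∷ []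
grow-sound {M} (one {m} {v} m<v inc) (m<M ∷ v<M) =
  (two m<v (m<M ∷ []) (All.lookup v<M (top∈word v)) inc leaf , refl ,
   ↭-trans (shift m (word v) _) (↭-trans (prep m (∷ʳ-↭ (word v) M)) (↭.swap m M ↭.refl))) ∷
  All.map⁺ (All.map step (grow-sound inc v<M))
  where
  step : ∀ {t′} → Grown M v t′ → Grown M (one m v) (one m t′)
  step (inc′ , eq , p) =
    one (All-resp-↭ (↭-sym p) (m<M ∷ m<v)) inc′ , eq , ↭-trans (prep m p) (↭.swap m M ↭.refl)
grow-sound {M} (two {u} {m} {v} m<u m<v u<v incᵤ incᵥ) t<M with All.++⁻ (word u) t<M
... | u<M , m<M ∷ v<M =
  All.++⁺ (All.map⁺ (All.map stepᵥ (grow-sound incᵥ v<M)))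
          (All.map⁺ (All.map stepᵤ (grow-sound incᵤ u<M)))
  where
  stepᵥ : ∀ {t′} → Grown M v t′ → Grown M (two u m v) (two u m t′)
  stepᵥ (inc′ , refl , p) =
    two m<u (All-resp-↭ (↭-sym p) (m<M ∷ m<v)) (All.lookup u<M (top∈word u)) incᵤ inc′ , refl ,
    ↭-trans (↭ₚ.++⁺ˡ (word u) (↭-trans (prep m p) (↭.swap m M ↭.refl))) (shift M (word u) _)

  stepᵤ : ∀ {t′} → Grown M u t′ → Grown M (two u m v) (two v m t′)
  stepᵤ {t′} (inc′ , refl , p) =
    two m<v (All-resp-↭ (↭-sym p) (m<M ∷ m<u)) (All.lookup v<M (top∈word v)) incᵥ inc′ , refl ,
    (begin
      word v ++ m ∷ word t′        ↭⟨ ↭ₚ.++⁺ˡ (word v) (prep m p) ⟩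
      word v ++ m ∷ M ∷ word u     ↭⟨ ↭ₚ.++⁺ˡ (word v) (↭.swap m M ↭.refl) ⟩
      word v ++ M ∷ m ∷ word u     ↭⟨ shift M (word v) _ ⟩
      M ∷ word v ++ m ∷ word u     ↭⟨ prep M (shift m (word v) _) ⟩
      M ∷ m ∷ word v ++ word u     ↭⟨ prep M (prep m (↭ₚ.++-comm (word v) (word u))) ⟩
      M ∷ m ∷ word u ++ word v     ↭⟨ prep M (shift m (word u) _) ⟨
      M ∷ word u ++ m ∷ word v     ∎)
    where open ↭.PermutationReasoning

unique-++ˡ : ∀ {A : Set} (xs : List A) {ys} → Unique (xs ++ ys) → Unique xs
unique-++ˡ []       _          = []
unique-++ˡ (x ∷ xs) (x∉ ∷ xs!) = All.++⁻ˡ xs x∉ ∷ unique-++ˡ xs xs!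

unique-++ʳ : ∀ {A : Set} (xs : List A) {ys} → Unique (xs ++ ys) → Unique ys
unique-++ʳ []       ys!       = ys!
unique-++ʳ (x ∷ xs) (_ ∷ xs!) = unique-++ʳ xs xs!

unique-++-≢ : ∀ {A : Set} (xs : List A) {ys x y} → Unique (xs ++ ys) → x ∈ xs → y ∈ ys → x ≢ y
unique-++-≢ (x ∷ xs) (x∉ ∷ _) (here refl) y∈ = All.lookup x∉ (∈-++⁺ʳ xs y∈)
unique-++-≢ (x ∷ xs) (_ ∷ xs!) (there x∈) y∈ = unique-++-≢ xs xs! x∈ y∈

-- Surjectivity of growth. If the right subtree, deprived of its maximum, still has a larger top
-- than u, the tree comes from the first half of `grow`; otherwise the subtrees of the predecessor
-- are exchanged and it comes from the second half. Distinct labels exclude a tie.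
shrink : ∀ {t} → Increasing t → Unique (word t) →
         (∃ λ m → t ≡ leaf m) ⊎
         (∃ λ t′ → Increasing t′ × t ∈ grow (top t) t′ × word t′ ↭ initial t)
shrink leaf _ = inj₁ (_ , refl)
shrink (one {m} {v} m<v inc) (_ ∷ v!) with shrink inc v!
... | inj₁ (_ , refl) = inj₂ (leaf m , leaf , here refl , ↭.refl)
... | inj₂ (v′ , inc′ , v∈ , p) = inj₂
  ( one m v′
  , one (All-resp-↭ (↭-sym p) (All.tail (All-resp-↭ (word-↭ v) m<v))) inc′
  , there (∈-map⁺ (one m) v∈)
  , prep m p)
shrink (two {u} {m} {v} m<u m<v u<v incᵤ incᵥ) t! with unique-++ʳ (word u) t!
... | _ ∷ v! with shrink incᵥ v!
... | inj₁ (_ , refl) = inj₂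
  (one m u , one m<u incᵤ , here refl , ↭-sym (∷ʳ-↭ (word u) m))
... | inj₂ (v′ , inc′ , v∈ , p) with All-resp-↭ (↭-sym p) (All.tail (All-resp-↭ (word-↭ v) m<v)) | top u ℕ.<? top v′
... | m<v′ | yes u<v′ = inj₂
  ( two u m v′ , two m<u m<v′ u<v′ incᵤ inc′
  , ∈-++⁺ˡ (∈-map⁺ (two u m) v∈)
  , ↭ₚ.++⁺ˡ (word u) (prep m p))
... | m<v′ | no  u≮v′ = inj₂
  ( two v′ m u , two m<v′ m<u (ℕ.≤∧≢⇒< (ℕ.≮⇒≥ u≮v′) (top≢ ∘ sym)) inc′ incᵤ
  , ∈-++⁺ʳ (map (two v′ m) (grow (top v) u)) (∈-map⁺ (two u m) v∈)
  , (begin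
      word v′ ++ m ∷ word u       ↭⟨ ↭ₚ.++⁺ʳ (m ∷ word u) p ⟩
      initial v ++ m ∷ word u     ↭⟨ shift m (initial v) _ ⟩
      m ∷ initial v ++ word u     ↭⟨ prep m (↭ₚ.++-comm (initial v) (word u)) ⟩
      m ∷ word u ++ initial v     ↭⟨ shift m (word u) _ ⟨
      word u ++ m ∷ initial v     ∎))
  where
  open ↭.PermutationReasoning
  top≢ : top u ≢ top v′
  top≢ = unique-++-≢ (word u) t! (top∈word u)
           (there (∈-resp-↭ (↭-sym (word-↭ v)) (there (∈-resp-↭ p (top∈word v′)))))

trees-sound : ∀ n → All (λ t → Increasing t × word t ↭ values n) (trees n)
trees-sound zero          = []
trees-sound (suc zero)    = (leaf , ↭.refl) ∷ []
trees-sound (suc (suc n)) = All.concat⁺ (All.map⁺ (All.map step (trees-sound (suc n))))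
  where
  step : ∀ {t} → Increasing t × word t ↭ values (suc n) →
         All (λ t → Increasing t × word t ↭ values (suc (suc n))) (grow (suc (suc n)) t)
  step (inc , p) = All.map (λ (inc′ , _ , q) → inc′ , ↭-trans q (prep _ p))
                           (grow-sound inc (All-resp-↭ (↭-sym p) (values< (suc n))))

trees-unique : ∀ n → Unique (trees n)
trees-unique zero          = []
trees-unique (suc zero)    = [] ∷ []
trees-unique (suc (suc n)) = concatMap-unique (grow (suc (suc n))) prune (trees-unique (suc n))
  (All.map (λ (inc , _) → grow-unique _ inc , prune-grow _ inc) (trees-sound (suc n)))

top-values : ∀ {t n} → Increasing t → word t ↭ values (suc n) → top t ≡ suc n
top-values {t} {n} inc p with ∈-resp-↭ (word-↭ t) (∈-resp-↭ (↭-sym p) (here refl))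
... | here eq  = sym eq
... | there n∈ = contradiction
  (All.lookup (values≤ (suc n)) (∈-resp-↭ p (top∈word t)))
  (ℕ.<⇒≱ (All.lookup (initial<top inc) n∈))

trees-complete : ∀ n {t} → Increasing t → word t ↭ values (suc n) → t ∈ trees (suc n)
trees-complete n {t} inc p with shrink inc (Unique-resp-↭ (↭-sym p) (values-unique (suc n)))
trees-complete zero {t} inc p | inj₁ (_ , refl) with refl ← ↭-singleton-inv p = here refl
trees-complete (suc n) {t} inc p | inj₁ (_ , refl) with () ← ↭-length p
trees-complete n {t} inc p | inj₂ (t′ , inc′ , t∈ , q)
  with eq ← top-values inc p
  with r ← ↭-trans q (drop-∷ (subst (λ x → x ∷ initial t ↭ values (suc n)) eq (↭-trans (↭-sym (word-↭ t)) p)))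
  with n
... | zero  = contradiction (subst (top t′ ∈_) (↭ₚ.↭-empty-inv r) (top∈word t′)) λ ()
... | suc n = ∈-concatMap⁺ (grow (suc (suc n)))
  (Any.map (λ { refl → subst (λ x → t ∈ grow x t′) eq t∈ }) (trees-complete n inc′ r))

-- Permutations generated by inserting the maximum

inserts : ℕ → List ℕ → List (List ℕ)
inserts M []      = [ [ M ] ]
inserts M (a ∷ w) = (M ∷ a ∷ w) ∷ map (a ∷_) (inserts M w)

perms : ℕ → List (List ℕ)
perms zero    = [ [] ]
perms (suc n) = concatMap (inserts (suc n)) (perms n)

inserts-sound : ∀ M w → All (_↭ M ∷ w) (inserts M w)
inserts-sound M []      = ↭.refl ∷ []
inserts-sound M (a ∷ w) =
  ↭.refl ∷ All.map⁺ (All.map (λ p → ↭-trans (prep a p) (↭.swap a M ↭.refl)) (inserts-sound M w))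

inserts-complete : ∀ M u v → u ++ M ∷ v ∈ inserts M (u ++ v)
inserts-complete M []      []      = here refl
inserts-complete M []      (a ∷ v) = here refl
inserts-complete M (a ∷ u) v       = there (∈-map⁺ (a ∷_) (inserts-complete M u v))

inserts-unique : ∀ {M w} → All (_≢ M) w → Unique (inserts M w)
inserts-unique []                   = [] ∷ []
inserts-unique {w = a ∷ w} (a≢M ∷ w≢M) =
  All.map⁺ (All.universal (λ _ eq → a≢M (sym (List.∷-injectiveˡ eq))) _) ∷
  Unique.map⁺ List.∷-injectiveʳ (inserts-unique w≢M)

remove : ℕ → List ℕ → List ℕ
remove M = filter (λ a → ¬? (a ℕ.≟ M))

remove-inserts : ∀ {M w} → All (_≢ M) w → All (λ w′ → remove M w′ ≡ w) (inserts M w)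
remove-inserts {M} [] = List.filter-reject (λ a → ¬? (a ℕ.≟ M)) (λ ne → ne refl) ∷ []
remove-inserts {M} (a≢M ∷ w≢M) =
  trans (List.filter-reject (λ a → ¬? (a ℕ.≟ M)) (λ ne → ne refl))
        (List.filter-all (λ a → ¬? (a ℕ.≟ M)) (a≢M ∷ w≢M)) ∷
  All.map⁺ (All.map (λ eq → trans (List.filter-accept (λ a → ¬? (a ℕ.≟ M)) a≢M) (cong (_ ∷_) eq))
                    (remove-inserts w≢M))

perms-sound : ∀ n → All (_↭ values n) (perms n)
perms-sound zero    = ↭.refl ∷ []
perms-sound (suc n) = All.concat⁺ (All.map⁺ (All.map
  (λ p → All.map (λ q → ↭-trans q (prep (suc n) p)) (inserts-sound (suc n) _)) (perms-sound n)))

perms-unique : ∀ n → Unique (perms n)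
perms-unique zero    = [] ∷ []
perms-unique (suc n) = concatMap-unique (inserts (suc n)) (just ∘ remove (suc n)) (perms-unique n)
  (All.map (λ p → let ne = All.map ℕ.<⇒≢ (All-resp-↭ (↭-sym p) (values< n)) in
                  inserts-unique ne , All.map (cong just) (remove-inserts ne))
           (perms-sound n))

perms-complete : ∀ n {w} → w ↭ values n → w ∈ perms n
perms-complete zero    p = here (↭ₚ.↭-empty-inv p)
perms-complete (suc n) p with ∈-∃++ (∈-resp-↭ (↭-sym p) (here refl))
... | u , v , refl = ∈-concatMap⁺ (inserts (suc n))
  (Any.map (λ { refl → inserts-complete (suc n) u v }) (perms-complete n (drop-mid u [] p)))

-- The André condition on words

-- Junk value 0 beyond the end, as for _⟨_⟩.
at : List ℕ → ℕ → ℕ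
at []      i       = 0
at (a ∷ w) zero    = a
at (a ∷ w) (suc i) = at w i

at-++ˡ : ∀ u v {i} → i < length u → at (u ++ v) i ≡ at u i
at-++ˡ (a ∷ u) v {zero}  _         = refl
at-++ˡ (a ∷ u) v {suc i} (s≤s i<u) = at-++ˡ u v i<u

at-++ʳ : ∀ u v i → at (u ++ v) (length u ℕ.+ i) ≡ at v i
at-++ʳ []      v i = refl
at-++ʳ (a ∷ u) v i = at-++ʳ u v i

at-∈ : ∀ w {i} → i < length w → at w i ∈ w
at-∈ (a ∷ w) {zero}  _         = here refl
at-∈ (a ∷ w) {suc i} (s≤s i<w) = there (at-∈ w i<w)

tabulate-at : ∀ {P : ℕ → Set} w → (∀ i → i < length w → P (at w i)) → All P w
tabulate-at []      f = []
tabulate-at (a ∷ w) f = f 0 (s≤s z≤n) ∷ tabulate-at w (λ i → f (suc i) ∘ s≤s)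

-- Condition (2) in the definition of André permutations, where j and j′
-- are i + 2 and j + 2 here, since positions start at 0.  Condition (1)
-- is the case j = 1 + i.
André : List ℕ → Set
André w = ∀ i j → i < j → suc j < length w →
  at w (suc i) ≤ at w i → at w j ≤ at w i →
  at w (suc j) ≤ at w (suc i) → at w (suc j) ≤ at w j →
  ∃ λ k → suc i < k × k < suc j × at w k < at w (suc j)

-- Stands for π(n) = n in a form that makes sense for factors of a permutation as well, as the
-- recursion on the tree requires.
LastMax : List ℕ → Set
LastMax w = ∃ λ xs → ∃ λ x → w ≡ xs ∷ʳ x × All (_< x) xs

André-++ˡ : ∀ u v → André (u ++ v) → André u
André-++ˡ u v andré i j i<j j<u
  with andré i j i<j (ℕ.<-≤-trans j<u (subst (length u ≤_) (sym (List.length-++ u)) (ℕ.m≤m+n _ _)))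
... | f
  rewrite at-++ˡ u v j<u
        | at-++ˡ u v (ℕ.<-trans (ℕ.n<1+n j) j<u)
        | at-++ˡ u v (ℕ.≤-<-trans i<j (ℕ.<-trans (ℕ.n<1+n j) j<u))
        | at-++ˡ u v (ℕ.<-trans i<j (ℕ.<-trans (ℕ.n<1+n j) j<u))
  = λ b≤a c≤a d≤b d≤c →
    let k , i<k , k<j , small = f b≤a c≤a d≤b d≤c in
    k , i<k , k<j , subst (_< at u (suc j)) (at-++ˡ u v (ℕ.<-trans k<j j<u)) small

André-++ʳ : ∀ u v → André (u ++ v) → André v
André-++ʳ []      v andré = andré
André-++ʳ (a ∷ u) v andré = André-++ʳ u v tail
  where
  tail : André (u ++ v)
  tail i j i<j j<w b≤a c≤a d≤b d≤c
    with andré (suc i) (suc j) (s≤s i<j) (s≤s j<w) b≤a c≤a d≤b d≤c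
  ... | suc k , s≤s i<k , s≤s k<j , small = k , i<k , k<j , small

-- If the last letter of u were not its maximum, some descent of u
-- would violate the condition against the final step down to m.
lastMax-before-min : ∀ us c m v → All (m <_) (us ∷ʳ c) → André ((us ∷ʳ c) ++ m ∷ v) → All (_< c) us
lastMax-before-min us c m v m<u andré =
  tabulate-at us λ i i<us → ℕ.≰⇒> (go (length us ∸ suc i) i (trans (ℕ.+-comm _ (suc i)) (ℕ.m+[n∸m]≡n i<us)))
  where
  u = us ∷ʳ c
  w = u ++ m ∷ v
  n = length us

  |u| : length u ≡ suc n
  |u| = trans (List.length-++ us) (ℕ.+-comm n 1)

  inner< : ∀ {i} → i ≤ n → i < length u
  inner< i≤n = subst (_ <_) (sym |u|) (s≤s i≤n)

  at-us : ∀ {i} → i < n → at w i ≡ at us i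
  at-us i<n = trans (at-++ˡ u _ (inner< (ℕ.<⇒≤ i<n))) (at-++ˡ us _ i<n)

  at-c : at w n ≡ c
  at-c = trans (at-++ˡ u _ (inner< ℕ.≤-refl)) (trans (cong (at u) (sym (ℕ.+-identityʳ n))) (at-++ʳ us [ c ] 0))

  at-m : at w (suc n) ≡ m
  at-m = trans (cong (at w) (trans (sym |u|) (sym (ℕ.+-identityʳ _)))) (at-++ʳ u _ 0)

  m<at : ∀ {i} → i ≤ n → m < at w i
  m<at i≤n = subst (m <_) (sym (at-++ˡ u _ (inner< i≤n))) (All.lookup m<u (at-∈ u (inner< i≤n)))

  n<w : suc n < length w
  n<w = subst₂ _<_ |u| (sym (List.length-++ u)) (ℕ.m<m+n (length u) (s≤s z≤n))

  -- The condition would apply to the descent at i together with the step from c down to m, but its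
  -- witness would be a letter of u smaller than m.
  descent : ∀ i → i < n → c ≤ at us i → ¬ at w (suc i) ≤ at w i
  descent i i<n c≤a b≤a
    with l , _ , s≤s l≤n , small ← andré i n i<n n<w b≤a
           (subst₂ _≤_ (sym at-c) (sym (at-us i<n)) c≤a)
           (subst (_≤ at w (suc i)) (sym at-m) (ℕ.<⇒≤ (m<at i<n)))
           (subst (_≤ at w n) (sym at-m) (ℕ.<⇒≤ (m<at ℕ.≤-refl)))
    = ℕ.<-asym (subst (at w l <_) at-m small) (m<at l≤n)

  -- Here k is the distance from position i + 1 to the final c. As long as there is no descent the
  -- letters stay at least c, and the step into c itself is then a descent.
  go : ∀ k i → k ℕ.+ suc i ≡ n → ¬ c ≤ at us i
  go zero    i eq   c≤a = descent i i<n c≤a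
    (subst₂ _≤_ (sym (trans (cong (at w) eq) at-c)) (sym (at-us i<n)) c≤a)
    where i<n = ℕ.≤-reflexive eq
  go (suc k) i eq   c≤a with at w (suc i) ℕ.≤? at w i
  ... | yes b≤a = descent i i<n c≤a b≤a
    where i<n = subst (suc i ≤_) eq (ℕ.m≤n+m (suc i) (suc k))
  ... | no  b≰a = go k (suc i) eq′
    (ℕ.≤-trans c≤a (ℕ.<⇒≤ (subst₂ _<_ (at-us (ℕ.<-trans (ℕ.n<1+n i) i<n)) (at-us i<n) (ℕ.≰⇒> b≰a))))
    where
    eq′ = trans (ℕ.+-suc k (suc i)) eq
    i<n = subst (suc (suc i) ≤_) eq′ (ℕ.m≤n+m _ k)

position : ∀ n i → i < n ⊎ ∃ λ k → i ≡ n ℕ.+ k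
position n i with i ℕ.<? n
... | yes i<n = inj₁ i<n
... | no  i≮n = inj₂ (i ∸ n , sym (ℕ.m+[n∸m]≡n (ℕ.≮⇒≥ i≮n)))

-- If the first step lies inside u and the second inside v, the minimum m between them is the
-- smaller letter asked for. Steps touching m never qualify: a step out of m ascends; a first step
-- into m would put a letter of v at or below m; a second step into m starts at the last letter of
-- u, which exceeds all earlier letters of u. Steps on one side of m are covered by the hypothesis
-- for that side.
André-min : ∀ u m v → All (m <_) u → All (m <_) v → u ≡ [] ⊎ LastMax u →
            André u → André v → André (u ++ m ∷ v)
André-min u m v m<u m<v last andréᵤ andréᵥ i j i<j j<w = main (position n j)
  where
  n = length u
  w = u ++ m ∷ v

  atˡ : ∀ {i} → i < n → at w i ≡ at u i
  atˡ = at-++ˡ u (m ∷ v)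

  atʳ : ∀ i → at w (n ℕ.+ i) ≡ at (m ∷ v) i
  atʳ = at-++ʳ u (m ∷ v)

  atʳ′ : ∀ i → at w (suc (n ℕ.+ i)) ≡ at v i
  atʳ′ i = trans (cong (at w) (sym (ℕ.+-suc n i))) (atʳ (suc i))

  at-n : at w n ≡ m
  at-n = trans (cong (at w) (sym (ℕ.+-identityʳ n))) (atʳ 0)

  last< : ∀ {i j} → u ≡ [] ⊎ LastMax u → i < j → suc j ≡ n → at u i < at u j
  last< (inj₁ refl) _ ()
  last< {i} {j} (inj₂ (xs , x , refl , xs<x)) i<j eq
    with refl ← ℕ.suc-injective (trans eq (trans (List.length-++ xs) (ℕ.+-comm _ 1)))
    = subst₂ _<_ (sym (at-++ˡ xs [ x ] i<j))
        (sym (trans (cong (at u) (sym (ℕ.+-identityʳ (length xs)))) (at-++ʳ xs [ x ] 0)))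
        (All.lookup xs<x (at-∈ xs i<j))

  bound : ∀ k → suc (n ℕ.+ k) < length w → k < length v
  bound k h = ℕ.+-cancelˡ-< (suc n) k (length v)
    (subst (suc (n ℕ.+ k) <_) (trans (List.length-++ u) (ℕ.+-suc n (length v))) h)

  Goal : ℕ → ℕ → Set
  Goal i j = at w (suc i) ≤ at w i → at w j ≤ at w i →
             at w (suc j) ≤ at w (suc i) → at w (suc j) ≤ at w j →
             ∃ λ k → suc i < k × k < suc j × at w k < at w (suc j)

  inRight : ∀ i j → i < j → suc j < length v → Goal (n ℕ.+ suc i) (n ℕ.+ suc j)
  inRight i j i<j j<v b≤a c≤a d≤b d≤c
    with k , i<k , k<j , small ← andréᵥ i j i<j j<v
           (subst₂ _≤_ (atʳ′ (suc i)) (atʳ (suc i)) b≤a)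
           (subst₂ _≤_ (atʳ (suc j)) (atʳ (suc i)) c≤a)
           (subst₂ _≤_ (atʳ′ (suc j)) (atʳ′ (suc i)) d≤b)
           (subst₂ _≤_ (atʳ′ (suc j)) (atʳ (suc j)) d≤c)
    = suc (n ℕ.+ k)
    , s≤s (ℕ.+-monoʳ-< n i<k)
    , s≤s (ℕ.+-monoʳ-< n k<j)
    , subst₂ _<_ (sym (atʳ′ k)) (sym (atʳ′ (suc j))) small

  main : j < n ⊎ (∃ λ k → j ≡ n ℕ.+ k) → Goal i j
  main (inj₁ j<n) with suc j ℕ.<? n
  ... | no j≮ = λ _ c≤a _ _ → contradiction
        (subst₂ _≤_ (atˡ j<n) (atˡ (ℕ.<-trans i<j j<n)) c≤a)
        (ℕ.<⇒≱ (last< last i<j (ℕ.≤-antisym j<n (ℕ.≮⇒≥ j≮))))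
  ... | yes 1+j<n
    rewrite atˡ 1+j<n | atˡ j<n | atˡ (ℕ.≤-<-trans i<j j<n) | atˡ (ℕ.<-trans i<j j<n)
    = λ b≤a c≤a d≤b d≤c →
      let k , i<k , k<j , small = andréᵤ i j i<j 1+j<n b≤a c≤a d≤b d≤c in
      k , i<k , k<j , subst (_< at u (suc j)) (sym (atˡ (ℕ.<-trans k<j 1+j<n))) small
  main (inj₂ (zero , refl)) _ _ _ d≤c = contradiction
    (subst₂ _≤_ (atʳ′ 0) (atʳ 0) d≤c)
    (ℕ.<⇒≱ (All.lookup m<v (at-∈ v (bound 0 j<w))))
  main (inj₂ (suc k , refl)) with position n i
  ... | inj₂ (zero , refl) = λ b≤a _ _ _ → contradiction
        (subst₂ _≤_ (atʳ′ 0) (atʳ 0) b≤a)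
        (ℕ.<⇒≱ (All.lookup m<v (at-∈ v (ℕ.≤-<-trans z≤n (bound (suc k) j<w)))))
  ... | inj₂ (suc l , refl) = inRight l k (ℕ.s<s⁻¹ (ℕ.+-cancelˡ-< n _ _ i<j)) (bound (suc k) j<w)
  ... | inj₁ i<n with suc i ℕ.<? n
  ...   | no i≮ = λ _ _ d≤b _ → contradiction
          (subst₂ _≤_ (atʳ′ (suc k)) (trans (cong (at w) (ℕ.≤-antisym i<n (ℕ.≮⇒≥ i≮))) at-n) d≤b)
          (ℕ.<⇒≱ (All.lookup m<v (at-∈ v (bound (suc k) j<w))))
  ...   | yes 1+i<n = λ _ _ _ _ →
          n , 1+i<n , s≤s (ℕ.m≤m+n n (suc k)) ,
          subst₂ _<_ (sym at-n) (sym (atʳ′ (suc k))) (All.lookup m<v (at-∈ v (bound (suc k) j<w)))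

word-LastMax : ∀ {t} → Increasing t → LastMax (word t)
word-LastMax {t} inc = initial t , top t , word≡initial∷ʳtop t , initial<top inc

word-André : ∀ {t} → Increasing t → André (word t)
word-André leaf = λ { _ _ _ (s≤s ()) }
word-André (one {m} {v} m<v inc) =
  André-min [] m (word v) [] m<v (inj₁ refl) (λ _ _ _ ()) (word-André inc)
word-André (two {u} {m} {v} m<u m<v u<v incᵤ incᵥ) =
  André-min (word u) m (word v) m<u m<v (inj₂ (word-LastMax incᵤ)) (word-André incᵤ) (word-André incᵥ)

-- Recovering a tree from its word

splitMin : ∀ a w → Unique (a ∷ w) → ∃ λ u → ∃ λ m → ∃ λ v →
           a ∷ w ≡ u ++ m ∷ v × All (m <_) u × All (m <_) v
splitMin a []      _ = [] , a , [] , refl , [] , []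
splitMin a (b ∷ w) (a∉ ∷ w!) with splitMin b w w!
... | u , m , v , eq , m<u , m<v with a ℕ.<? m
...   | yes a<m = [] , a , b ∷ w , refl , [] ,
        subst (All (a <_)) (sym eq) (All.++⁺ (All.map (ℕ.<-trans a<m) m<u) (a<m ∷ All.map (ℕ.<-trans a<m) m<v))
...   | no a≮m = a ∷ u , m , v , cong (a ∷_) eq ,
        ℕ.≤∧≢⇒< (ℕ.≮⇒≥ a≮m) (All.lookup a∉ (subst (m ∈_) (sym eq) (∈-++⁺ʳ u (here refl))) ∘ sym) ∷ m<u ,
        m<v

lastMax-∷ʳ : ∀ u ys y → LastMax (u ++ ys ∷ʳ y) → All (_< y) (u ++ ys)
lastMax-∷ʳ u ys y (xs , x , eq , xs<x)
  with refl , refl ← List.∷ʳ-injective xs (u ++ ys) (trans (sym eq) (sym (List.++-assoc u ys [ y ])))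
  = xs<x

mutual
  -- The factors around the minimum are not structural parts of the word, so the recursion runs on a
  -- bound n for the length.
  parse : ∀ n w → length w ≤ n → Unique w → LastMax w → André w →
          ∃ λ t → Increasing t × word t ≡ w
  parse n       []      _         _  ([] , _ , () , _) _
  parse n       []      _         _  (_ ∷ _ , _ , () , _) _
  parse (suc n) (a ∷ w) (s≤s |w|) w! last andré with splitMin a w w!
  ... | u , m , v , eq , m<u , m<v
    with t , inc , eq′ ← assemble n u m v
           (subst (_≤ n) (ℕ.suc-injective (trans (cong length eq) (trans (List.length-++ u) (ℕ.+-suc _ _)))) |w|)
           m<u m<v (subst Unique eq w!) (subst LastMax eq last) (subst André eq andré)
    = t , inc , trans eq′ (sym eq)

  -- The right factor inherits its final maximum from the whole word, while for the left factor it
  -- comes from `lastMax-before-min`. A nonempty u with an empty v is impossible: m would be last,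
  -- hence the maximum, and at the same time below the letters of u.
  assemble : ∀ n u m v → length u ℕ.+ length v ≤ n → All (m <_) u → All (m <_) v →
             Unique (u ++ m ∷ v) → LastMax (u ++ m ∷ v) → André (u ++ m ∷ v) →
             ∃ λ t → Increasing t × word t ≡ u ++ m ∷ v
  assemble n u m v |uv| m<u m<v w! last andré with initLast u | initLast v
  ... | []       | []       = leaf m , leaf , refl
  ... | us ∷ʳ′ c | []       = contradiction
    (All.lookup m<u (∈-++⁺ʳ us (here refl)))
    (ℕ.<-asym (All.lookup (lastMax-∷ʳ (us ∷ʳ c) [] m last) (∈-++⁺ˡ (∈-++⁺ʳ us (here refl)))))
  ... | []       | ys ∷ʳ′ y
    with tᵥ , incᵥ , eqᵥ ← parse n (ys ∷ʳ y) |uv| (unique-++ʳ [ m ] w!)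
           (ys , y , refl , All.tail (lastMax-∷ʳ [] (m ∷ ys) y last)) (André-++ʳ [ m ] _ andré)
    = one m tᵥ , one (subst (All (m <_)) (sym eqᵥ) m<v) incᵥ , cong (m ∷_) eqᵥ
  ... | us ∷ʳ′ c | ys ∷ʳ′ y
    with ws<y ← lastMax-∷ʳ (us ∷ʳ c) (m ∷ ys) y last
    with tᵤ , incᵤ , eqᵤ ← parse n (us ∷ʳ c) (ℕ.≤-trans (ℕ.m≤m+n _ _) |uv|) (unique-++ˡ (us ∷ʳ c) w!)
           (us , c , refl , lastMax-before-min us c m _ m<u andré) (André-++ˡ (us ∷ʳ c) _ andré)
    with tᵥ , incᵥ , eqᵥ ← parse n (ys ∷ʳ y) (ℕ.≤-trans (ℕ.m≤n+m _ _) |uv|)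
           (unique-++ʳ [ m ] (unique-++ʳ (us ∷ʳ c) w!))
           (ys , y , refl , All.tail (All.++⁻ʳ (us ∷ʳ c) ws<y))
           (André-++ʳ [ m ] _ (André-++ʳ (us ∷ʳ c) _ andré))
    -- Identifies y with `top tᵥ`, so that the bound y on the letters of u becomes the required
    -- comparison of tops.
    with refl ← List.∷ʳ-injectiveʳ (initial tᵥ) ys (trans (sym (word≡initial∷ʳtop tᵥ)) eqᵥ)
    = two tᵤ m tᵥ
    , two (subst (All (m <_)) (sym eqᵤ) m<u) (subst (All (m <_)) (sym eqᵥ) m<v)
          (All.lookup ws<y (∈-++⁺ˡ (subst (top tᵤ ∈_) eqᵤ (top∈word tᵤ)))) incᵤ incᵥ
    , cong₂ (λ u v → u ++ m ∷ v) eqᵤ eqᵥ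

-- Vectors as words

toWord : ∀ {n m} → Vec (Fin n) m → List ℕ
toWord []      = []
toWord (a ∷ π) = suc (toℕ a) ∷ toWord π

⟨⟩≡at : ∀ {n m} (π : Vec (Fin n) m) i → π ⟨ suc i ⟩ ≡ at (toWord π) i
⟨⟩≡at []      i       = refl
⟨⟩≡at (a ∷ π) zero    = refl
⟨⟩≡at (a ∷ π) (suc i) = ⟨⟩≡at π i

length-toWord : ∀ {n m} (π : Vec (Fin n) m) → length (toWord π) ≡ m
length-toWord []      = refl
length-toWord (a ∷ π) = cong suc (length-toWord π)

toWord-injective : ∀ {n m} {π σ : Vec (Fin n) m} → toWord π ≡ toWord σ → π ≡ σ
toWord-injective {π = []}    {[]}    eq = refl
toWord-injective {π = a ∷ π} {b ∷ σ} eq =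
  cong₂ _∷_ (Fin.toℕ-injective (ℕ.suc-injective (List.∷-injectiveˡ eq)))
            (toWord-injective (List.∷-injectiveʳ eq))

toWord-∈-values : ∀ {n m} (π : Vec (Fin n) m) → All (_∈ values n) (toWord π)
toWord-∈-values []      = []
toWord-∈-values (a ∷ π) = ∈-applyDownFrom⁺ suc (Fin.toℕ<n a) ∷ toWord-∈-values π

toWord-surjective : ∀ {n m} w → length w ≡ m → All (_∈ values n) w →
                    ∃ λ (π : Vec (Fin n) m) → toWord π ≡ w
toWord-surjective []      refl []         = [] , refl
toWord-surjective (a ∷ w) refl (a∈ ∷ w∈) with ∈-applyDownFrom⁻ suc a∈ | toWord-surjective w refl w∈
... | i , i<n , refl | π , eq = fromℕ< i<n ∷ π , cong₂ _∷_ (cong suc (Fin.toℕ-fromℕ< i<n)) eq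

toWord-unique⁺ : ∀ {n m} {π : Vec (Fin n) m} → Vec.Unique π → Unique (toWord π)
toWord-unique⁺ VecAllPairs.[] = []
toWord-unique⁺ (a∉ VecAllPairs.∷ π!) = go a∉ ∷ toWord-unique⁺ π!
  where
  go : ∀ {n m} {a : Fin n} {π : Vec (Fin n) m} → VecAll.All (a ≢_) π → All (suc (toℕ a) ≢_) (toWord π)
  go VecAll.[]           = []
  go (a≢b VecAll.∷ a≢π) = a≢b ∘ Fin.toℕ-injective ∘ ℕ.suc-injective ∷ go a≢π

toWord-unique⁻ : ∀ {n m} {π : Vec (Fin n) m} → Unique (toWord π) → Vec.Unique π
toWord-unique⁻ {π = []} _ = VecAllPairs.[]
toWord-unique⁻ {π = a ∷ π} (a∉ ∷ π!) = go a∉ VecAllPairs.∷ toWord-unique⁻ π!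
  where
  go : ∀ {n m} {a : Fin n} {π : Vec (Fin n) m} → All (suc (toℕ a) ≢_) (toWord π) → VecAll.All (a ≢_) π
  go {π = []}    []          = VecAll.[]
  go {π = b ∷ π} (a≢b ∷ a≢π) = a≢b ∘ cong (suc ∘ toℕ) VecAll.∷ go a≢π

words-complete : ∀ {n m} (π : Vec (Fin n) m) → π ∈ words n m
words-complete []      = here refl
words-complete (a ∷ π) = ∈-cartesianProductWith⁺ _∷_ (∈-allFin a) (words-complete π)

words-unique : ∀ n m → Unique (words n m)
words-unique n zero    = [] ∷ []
words-unique n (suc m) = Unique.cartesianProductWith⁺ _∷_ (λ { refl → refl , refl })
  (Unique.allFin⁺ n) (words-unique n m)

-- Deleting each x from ys keeps the rest of xs inside what remains, and the length bound leaves
-- nothing over. This is how a vector without repetitions is seen to contain every value.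
pigeonhole : ∀ {A : Set} {xs ys : List A} → Unique xs → All (_∈ ys) xs → length ys ≤ length xs → xs ↭ ys
pigeonhole {xs = []}     {[]} _          _          _    = ↭.refl
pigeonhole {xs = x ∷ xs}      (x∉ ∷ xs!) (x∈ ∷ xs∈) |ys| with ∈-∃++ x∈
... | as , bs , refl = ↭-trans (prep x (pigeonhole xs! (All.tabulate sub) len)) (↭-sym (shift x as bs))
  where
  len : length (as ++ bs) ≤ length xs
  len = ℕ.s≤s⁻¹ (subst (_≤ suc (length xs)) (↭-length (shift x as bs)) |ys|)

  sub : ∀ {y} → y ∈ xs → y ∈ as ++ bs
  sub y∈ with ∈-resp-↭ (shift x as bs) (All.lookup xs∈ y∈)
  ... | here refl = contradiction refl (All.lookup x∉ y∈)
  ... | there y∈′ = y∈′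

toWord-↭-values : ∀ {n} {π : Vec (Fin n) n} → π ∈ 𝔖 n → toWord π ↭ values n
toWord-↭-values {n} {π} π∈ = pigeonhole
  (toWord-unique⁺ (proj₂ (∈-filter⁻ unique? {xs = words n n} π∈)))
  (toWord-∈-values π)
  (ℕ.≤-reflexive (trans (List.length-applyDownFrom suc n) (sym (length-toWord π))))

𝔖-word : ∀ {n w} → w ↭ values n → ∃ λ (π : Vec (Fin n) n) → π ∈ 𝔖 n × toWord π ≡ w
𝔖-word {n} {w} p
  with π , refl ← toWord-surjective {n} w (trans (↭-length p) (List.length-applyDownFrom suc n))
                    (All.tabulate (∈-resp-↭ p))
  = π , ∈-filter⁺ unique? (words-complete π) (toWord-unique⁻ (Unique-resp-↭ (↭-sym p) (values-unique n))) , refl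

𝔖-unique : ∀ n → Unique (𝔖 n)
𝔖-unique n = Unique.filter⁺ unique? (words-unique n n)

𝔖↭perms : ∀ n → map toWord (𝔖 n) ↭ perms n
𝔖↭perms n = unique-↭ (Unique.map⁺ toWord-injective (𝔖-unique n)) (perms-unique n) to from
  where
  to : ∀ {w} → w ∈ map toWord (𝔖 n) → w ∈ perms n
  to w∈ with π , π∈ , refl ← ∈-map⁻ toWord w∈ = perms-complete n (toWord-↭-values π∈)

  from : ∀ {w} → w ∈ perms n → w ∈ map toWord (𝔖 n)
  from w∈ with π , π∈ , refl ← 𝔖-word (All.lookup (perms-sound n) w∈) = ∈-map⁺ toWord π∈

-- Matching the word condition with the definition of André permutations

m<n∸o⇒o+m<n : ∀ o {m n} → m < n ∸ o → o ℕ.+ m < n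
m<n∸o⇒o+m<n zero            m<n = m<n
m<n∸o⇒o+m<n (suc o) {n = suc n} m<n = s≤s (m<n∸o⇒o+m<n o m<n)

-- Four comparisons suffice for the max-min condition of `Extremal`, since d ≤ a follows by
-- transitivity.
extremal : ∀ {a b c d} → b ≤ a → c ≤ a → d ≤ b → d ≤ c →
           a ≡ a ⊔ b ⊔ c ⊔ d × d ≡ a ⊓ b ⊓ c ⊓ d
extremal b≤a c≤a d≤b d≤c =
  ℕ.≤-antisym (ℕ.≤-trans (ℕ.m≤m⊔n _ _) (ℕ.≤-trans (ℕ.m≤m⊔n _ _) (ℕ.m≤m⊔n _ _)))
              (ℕ.⊔-lub (ℕ.⊔-lub (ℕ.⊔-lub ℕ.≤-refl b≤a) c≤a) d≤a) ,
  sym (ℕ.m≥n⇒m⊓n≡n (ℕ.⊓-glb (ℕ.⊓-glb d≤a d≤b) d≤c))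
  where d≤a = ℕ.≤-trans d≤b b≤a

extremal⁻ : ∀ a b c d → a ≡ a ⊔ b ⊔ c ⊔ d → d ≡ a ⊓ b ⊓ c ⊓ d →
            b ≤ a × c ≤ a × d ≤ b × d ≤ c
extremal⁻ a b c d max min =
  ℕ.m⊔n≤o⇒n≤o a b a⊔b≤a ,
  ℕ.m⊔n≤o⇒n≤o (a ⊔ b) c a⊔b⊔c≤a ,
  ℕ.m≤n⊓o⇒m≤o a b (ℕ.m≤n⊓o⇒m≤n (a ⊓ b) c d≤a⊓b⊓c) ,
  ℕ.m≤n⊓o⇒m≤o (a ⊓ b) c d≤a⊓b⊓c
  where
  a⊔b⊔c≤a : a ⊔ b ⊔ c ≤ a
  a⊔b⊔c≤a = ℕ.m⊔n≤o⇒m≤o (a ⊔ b ⊔ c) d (ℕ.≤-reflexive (sym max))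

  a⊔b≤a : a ⊔ b ≤ a
  a⊔b≤a = ℕ.m⊔n≤o⇒m≤o (a ⊔ b) c a⊔b⊔c≤a

  d≤a⊓b⊓c : d ≤ a ⊓ b ⊓ c
  d≤a⊓b⊓c = ℕ.m≤n⊓o⇒m≤n (a ⊓ b ⊓ c) d (ℕ.≤-reflexive min)

module _ {n : ℕ} {π : Vec (Fin (suc n)) (suc n)} where

  private
    w = toWord π

    get : ∀ i → π ⟨ suc i ⟩ ≡ at w i
    get = ⟨⟩≡at π

    |w| : length w ≡ suc n
    |w| = length-toWord π

  IsAndré⇒André : IsAndré π → André w
  IsAndré⇒André (_ , andré) i j i<j 1+j<w b≤a c≤a d≤b d≤c
    with j<n ← ℕ.s<s⁻¹ (subst (suc j <_) |w| 1+j<w)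
    with k , k< , small ← Any.applyUpTo⁻ (suc (suc (suc i)) ℕ.+_)
           (All.applyUpTo⁻ (2 ℕ.+_) n (All.applyUpTo⁻ (2 ℕ.+_) n andré (ℕ.<-trans i<j j<n)) j<n
             (s≤s (s≤s i<j)) (extremal
               (subst₂ _≤_ (sym (get (suc i))) (sym (get i)) b≤a)
               (subst₂ _≤_ (sym (get j)) (sym (get i)) c≤a)
               (subst₂ _≤_ (sym (get (suc j))) (sym (get (suc i))) d≤b)
               (subst₂ _≤_ (sym (get (suc j))) (sym (get j)) d≤c)))
    -- The range of j″ begins at 3 + i when positions are counted from 1, hence at 2 + i when they
    -- are counted from 0.
    = 2 ℕ.+ i ℕ.+ k
    , s≤s (s≤s (ℕ.m≤m+n i k))
    , s≤s (m<n∸o⇒o+m<n (suc i) k<)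
    , subst₂ _<_ (get (2 ℕ.+ i ℕ.+ k)) (get (suc j)) small

  André⇒IsAndré : André w → IsAndré π
  André⇒IsAndré andré = noDoubleDescent , All.applyUpTo⁺₁ _ n (λ {i} i<n → All.applyUpTo⁺₁ _ n (λ {j} j<n → between i j j<n))
    where
    noDoubleDescent : ¬ Any (DoubleDescent π) (interval 2 n)
    noDoubleDescent dd
      with i , i<n-1 , b<a , c<b ← Any.applyUpTo⁻ (2 ℕ.+_) dd
      with b≤a ← ℕ.<⇒≤ (subst₂ _<_ (get (suc i)) (get i) b<a)
      with c≤b ← ℕ.<⇒≤ (subst₂ _<_ (get (2 ℕ.+ i)) (get (suc i)) c<b)
      with k , i<k , k<i , _ ← andré i (suc i) (ℕ.n<1+n i)
             (subst (2 ℕ.+ i <_) (sym |w|) (s≤s (m<n∸o⇒o+m<n 1 i<n-1))) b≤a b≤a c≤b c≤b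
      = ℕ.<⇒≱ i<k (ℕ.s≤s⁻¹ k<i)

    between : ∀ i j → j < n → 2 ℕ.+ i < 2 ℕ.+ j → Extremal π (2 ℕ.+ i) (2 ℕ.+ j) → SmallerBetween π (2 ℕ.+ i) (2 ℕ.+ j)
    between i j j<n (s≤s (s≤s i<j)) (max , min)
      with b≤a , c≤a , d≤b , d≤c ← extremal⁻ (π ⟨ suc i ⟩) (π ⟨ 2 ℕ.+ i ⟩) (π ⟨ suc j ⟩) _ max min
      with k , i<k , k<j , small ← andré i j i<j (subst (suc j <_) (sym |w|) (s≤s j<n))
             (subst₂ _≤_ (get (suc i)) (get i) b≤a)
             (subst₂ _≤_ (get j) (get i) c≤a)
             (subst₂ _≤_ (get (suc j)) (get (suc i)) d≤b)
             (subst₂ _≤_ (get (suc j)) (get j) d≤c)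
      with eq ← ℕ.m+[n∸m]≡n i<k
      = Any.applyUpTo⁺ _
          (subst₂ _<_ (sym (get _)) (sym (get (suc j))) (subst (λ k → at w k < at w (suc j)) (sym eq) small))
          (ℕ.∸-monoˡ-< k<j i<k)

LastMax⇒last : ∀ {n} {π : Vec (Fin (suc n)) (suc n)} → toWord π ↭ values (suc n) →
               LastMax (toWord π) → π ⟨ suc n ⟩ ≡ suc n
LastMax⇒last {n} {π} p (xs , x , eq , xs<x) =
  trans (⟨⟩≡at π n) (trans (cong (λ w → at w n) eq) (trans (cong (at (xs ∷ʳ x)) n≡) (trans (at-++ʳ xs [ x ] 0) x≡)))
  where
  q : xs ∷ʳ x ↭ values (suc n)
  q = subst (_↭ values (suc n)) eq p

  n≡ : n ≡ length xs ℕ.+ 0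
  n≡ = ℕ.suc-injective (trans (sym (length-toWord π)) (trans (cong length eq)
         (trans (List.length-++ xs) (trans (ℕ.+-suc _ 0) refl))))

  x≡ : x ≡ suc n
  x≡ with ∈-++⁻ xs (∈-resp-↭ (↭-sym q) (here refl))
  ... | inj₂ (here eq) = sym eq
  ... | inj₁ n∈        = contradiction (All.lookup xs<x n∈)
    (ℕ.≤⇒≯ (All.lookup (values≤ (suc n)) (∈-resp-↭ q (∈-++⁺ʳ xs (here refl)))))

last⇒LastMax : ∀ {n} {π : Vec (Fin (suc n)) (suc n)} → toWord π ↭ values (suc n) →
               π ⟨ suc n ⟩ ≡ suc n → LastMax (toWord π)
last⇒LastMax {n} {π} p last = go (toWord π) p (length-toWord π) (trans (sym (⟨⟩≡at π n)) last)
  where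
  go : ∀ w → w ↭ values (suc n) → length w ≡ suc n → at w n ≡ suc n → LastMax w
  go w p |w| last with initLast w
  go .(xs ∷ʳ x) p |w| last | xs ∷ʳ′ x
    with refl ← trans (sym (at-++ʳ xs [ x ] 0)) (trans (cong (at (xs ∷ʳ x))
                  (trans (ℕ.+-identityʳ _) (ℕ.suc-injective (trans (sym (trans (List.length-++ xs) (ℕ.+-comm _ 1))) |w|)))) last)
    = xs , x , refl , All-resp-↭ (↭-sym (subst (_↭ values n) (List.++-identityʳ xs) (drop-mid xs [] p))) (values< n)

-- Injectivity is asked only on P because `word` is injective on increasing trees but not on all
-- trees.
map-unique : ∀ {A B : Set} {P : A → Set} (f : A → B) → (∀ {x y} → P x → P y → f x ≡ f y → x ≡ y) →
             ∀ {xs} → All P xs → Unique xs → Unique (map f xs)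
map-unique f inj []         []         = []
map-unique f inj (px ∷ pxs) (x∉ ∷ xs!) =
  All.map⁺ (All.zipWith (λ (py , x≢y) → x≢y ∘ inj px py) (pxs , x∉)) ∷ map-unique f inj pxs xs!

-- If one left part ended before the other, each of m and m′ would occur among letters that exceed
-- the other.
splitMin-injective : ∀ u {m v} u′ {m′ v′} → All (m <_) u → All (m <_) v → All (m′ <_) u′ → All (m′ <_) v′ →
                     u ++ m ∷ v ≡ u′ ++ m′ ∷ v′ → u ≡ u′ × m ≡ m′ × v ≡ v′
splitMin-injective []      []        _ _ _ _ refl = refl , refl , refl
splitMin-injective []      (a′ ∷ u′) _ m<v (m′<a′ ∷ _) _ refl =
  contradiction m′<a′ (ℕ.<-asym (All.lookup m<v (∈-++⁺ʳ u′ (here refl))))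
splitMin-injective (a ∷ u) []        (m<a ∷ _) _ _ m′<v′ refl =
  contradiction m<a (ℕ.<-asym (All.lookup m′<v′ (∈-++⁺ʳ u (here refl))))
splitMin-injective (a ∷ u) (a′ ∷ u′) (_ ∷ m<u) m<v (_ ∷ m′<u′) m′<v′ eq
  with refl , eq′ ← List.∷-injective eq
  with refl , refl , refl ← splitMin-injective u u′ m<u m<v m′<u′ m′<v′ eq′
  = refl , refl , refl

word≢[] : ∀ t → word t ≢ []
word≢[] t eq = contradiction (subst (top t ∈_) eq (top∈word t)) λ ()

word-injective : ∀ {t t′} → Increasing t → Increasing t′ → word t ≡ word t′ → t ≡ t′
word-injective leaf leaf refl = refl
word-injective leaf (one {v = v′} _ _) eq = contradiction (sym (List.∷-injectiveʳ eq)) (word≢[] v′)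
word-injective (one {v = v} _ _) leaf eq = contradiction (List.∷-injectiveʳ eq) (word≢[] v)
word-injective (one _ inc) (one _ inc′) eq
  with refl , eq′ ← List.∷-injective eq with refl ← word-injective inc inc′ eq′ = refl
word-injective leaf (two {u = u′} m′<u′ m′<v′ _ _ _) eq =
  contradiction (sym (proj₁ (splitMin-injective [] (word u′) [] [] m′<u′ m′<v′ eq))) (word≢[] u′)
word-injective (one m<v _) (two {u = u′} m′<u′ m′<v′ _ _ _) eq =
  contradiction (sym (proj₁ (splitMin-injective [] (word u′) [] m<v m′<u′ m′<v′ eq))) (word≢[] u′)
word-injective (two {u = u} m<u m<v _ _ _) leaf eq =
  contradiction (proj₁ (splitMin-injective (word u) [] m<u m<v [] [] eq)) (word≢[] u)
word-injective (two {u = u} m<u m<v _ _ _) (one m′<v′ _) eq =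
  contradiction (proj₁ (splitMin-injective (word u) [] m<u m<v [] m′<v′ eq)) (word≢[] u)
word-injective (two {u = u} m<u m<v _ incᵤ incᵥ) (two {u = u′} m′<u′ m′<v′ _ incᵤ′ incᵥ′) eq
  with equ , refl , eqv ← splitMin-injective (word u) (word u′) m<u m<v m′<u′ m′<v′ eq
  with refl ← word-injective incᵤ incᵤ′ equ with refl ← word-injective incᵥ incᵥ′ eqv = refl

𝔄↭trees : ∀ n → map toWord (𝔄 (suc n)) ↭ map word (trees (suc n))
𝔄↭trees n = unique-↭
  (Unique.map⁺ toWord-injective (Unique.filter⁺ isAugmentedAndré? (𝔖-unique (suc n))))
  (map-unique word word-injective (All.map proj₁ (trees-sound (suc n))) (trees-unique (suc n)))
  to from
  where
  to : ∀ {w} → w ∈ map toWord (𝔄 (suc n)) → w ∈ map word (trees (suc n))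
  to w∈
    with π , π∈ , refl ← ∈-map⁻ toWord w∈
    with π∈𝔖 , andré , last ← ∈-filter⁻ isAugmentedAndré? {xs = 𝔖 (suc n)} π∈
    with p ← toWord-↭-values π∈𝔖
    with t , inc , eq ← parse _ (toWord π) ℕ.≤-refl (Unique-resp-↭ (↭-sym p) (values-unique (suc n)))
                          (last⇒LastMax p last) (IsAndré⇒André andré)
    = subst (_∈ map word (trees (suc n))) eq
        (∈-map⁺ word (trees-complete n inc (subst (_↭ values (suc n)) (sym eq) p)))

  from : ∀ {w} → w ∈ map word (trees (suc n)) → w ∈ map toWord (𝔄 (suc n))
  from w∈
    with t , t∈ , refl ← ∈-map⁻ word w∈
    with inc , p ← All.lookup (trees-sound (suc n)) t∈
    with π , π∈ , eq ← 𝔖-word p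
    = subst (_∈ map toWord (𝔄 (suc n))) eq
        (∈-map⁺ toWord (∈-filter⁺ isAugmentedAndré? π∈
          ( André⇒IsAndré (subst André (sym eq) (word-André inc))
          , LastMax⇒last (toWord-↭-values π∈) (subst LastMax (sym eq) (word-LastMax inc)))))

-- Peaks and turns

ind : Bool → ℕ
ind b = if b then 1 else 0

-- A sliding window in which p is the letter before the word: the conventional π(0) = 0 for left
-- peaks, the first letter of the permutation for direction changes.
countTriples : (ℕ → ℕ → ℕ → Bool) → ℕ → List ℕ → ℕ
countTriples f p []          = 0
countTriples f p (a ∷ [])    = 0
countTriples f p (a ∷ b ∷ w) = ind (f p a b) ℕ.+ countTriples f a (b ∷ w)

count-∷ : ∀ {A : Set} {P : A → Set} (P? : Decidable P) x xs →
          count P? (x ∷ xs) ≡ ind (does (P? x)) ℕ.+ count P? xs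
count-∷ P? x xs with does (P? x)
... | true  = refl
... | false = refl

count-triples : ∀ {P : ℕ → Set} (P? : Decidable P) φ f p w →
  (∀ i → does (P? (φ i)) ≡ f (at (p ∷ w) i) (at w i) (at w (suc i))) →
  count P? (applyUpTo φ (length w ∸ 1)) ≡ countTriples f p w
count-triples P? φ f p []          eq = refl
count-triples P? φ f p (a ∷ [])    eq = refl
count-triples P? φ f p (a ∷ b ∷ w) eq =
  trans (count-∷ P? (φ 0) _) (cong₂ ℕ._+_ (cong ind (eq 0)) (count-triples P? (φ ∘ suc) f a (b ∷ w) (eq ∘ suc)))

isPeak isTurn : ℕ → ℕ → ℕ → Bool
isPeak a b c = (a <ᵇ b) ∧ (c <ᵇ b)
isTurn a b c = isPeak a b c ∨ ((b <ᵇ a) ∧ (b <ᵇ c))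

leftPeaks≡ : ∀ {n} (π : Vec (Fin n) n) → leftPeaks π ≡ countTriples isPeak 0 (toWord π)
leftPeaks≡ π = subst (λ m → count (peak? π) (applyUpTo suc (m ∸ 1)) ≡ countTriples isPeak 0 (toWord π))
  (length-toWord π) (count-triples (peak? π) suc isPeak 0 (toWord π) agree)
  where
  at-0 : ∀ i → π ⟨ i ⟩ ≡ at (0 ∷ toWord π) i
  at-0 zero    = refl
  at-0 (suc i) = ⟨⟩≡at π i

  agree : ∀ i → does (peak? π (suc i)) ≡ isPeak (at (0 ∷ toWord π) i) (at (toWord π) i) (at (toWord π) (suc i))
  agree i rewrite at-0 i | ⟨⟩≡at π i | ⟨⟩≡at π (suc i) = refl

directionChanges≡ : ∀ {n} a (π : Vec (Fin (2 ℕ.+ n)) (suc n)) →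
                    directionChanges (a ∷ π) ≡ countTriples isTurn (suc (toℕ a)) (toWord π)
directionChanges≡ {n} a π = subst (λ m → count turn? (applyUpTo (2 ℕ.+_) (m ∸ 1)) ≡ countTriples isTurn _ (toWord π))
  (length-toWord π) (count-triples turn? (2 ℕ.+_) isTurn (suc (toℕ a)) (toWord π) agree)
  where
  turn? : Decidable (λ i → Peak (a ∷ π) i ⊎ Valley (a ∷ π) i)
  turn? i = peak? (a ∷ π) i ⊎-dec valley? (a ∷ π) i

  agree : ∀ i → does (turn? (2 ℕ.+ i)) ≡
          isTurn (at (toWord (a ∷ π)) i) (at (toWord π) i) (at (toWord π) (suc i))
  agree i rewrite ⟨⟩≡at (a ∷ π) i | ⟨⟩≡at π i | ⟨⟩≡at π (suc i) = refl

stepsFrom : ℕ → List ℕ → List Bool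
stepsFrom a []      = []
stepsFrom a (b ∷ w) = (a <ᵇ b) ∷ stepsFrom b w

steps : List ℕ → List Bool
steps []      = []
steps (a ∷ w) = stepsFrom a w

length-stepsFrom : ∀ a w → length (stepsFrom a w) ≡ length w
length-stepsFrom a []      = refl
length-stepsFrom a (b ∷ w) = cong suc (length-stepsFrom b w)

<⇒<ᵇ : ∀ {a b} → a < b → (a <ᵇ b) ≡ true
<⇒<ᵇ {a} {b} = dec-true (a ℕ.<? b)

>⇒≮ᵇ : ∀ {a b} → b < a → (a <ᵇ b) ≡ false
>⇒≮ᵇ {a} {b} b<a = dec-false (a ℕ.<? b) (ℕ.<-asym b<a)

<ᵇ-swap : ∀ {a b} → a ≢ b → (b <ᵇ a) ≡ not (a <ᵇ b)
<ᵇ-swap {a} {b} a≢b with ℕ.<-cmp a b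
... | tri< a<b _ _ rewrite <⇒<ᵇ a<b | >⇒≮ᵇ a<b = refl
... | tri≈ _ a≡b _ = contradiction a≡b a≢b
... | tri> _ _ b<a rewrite <⇒<ᵇ b<a | >⇒≮ᵇ b<a = refl

turns≡changes : ∀ p a w → Unique (p ∷ a ∷ w) →
                countTriples isTurn p (a ∷ w) ≡ changes (p <ᵇ a) (stepsFrom a w)
turns≡changes p a []      _ = refl
turns≡changes p a (b ∷ w) ((p≢a ∷ _) ∷ w!@((a≢b ∷ _) ∷ _))
  rewrite turns≡changes a b w w! | <ᵇ-swap p≢a | <ᵇ-swap a≢b
  with p <ᵇ a | a <ᵇ b
... | true  | true  = refl
... | true  | false = refl
... | false | true  = refl
... | false | false = refl

changes+repeats : ∀ p s → changes p s ℕ.+ repeats p s ≡ length s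
changes+repeats p     []          = refl
changes+repeats true  (true ∷ s)  = trans (ℕ.+-suc _ _) (cong suc (changes+repeats true s))
changes+repeats true  (false ∷ s) = cong suc (changes+repeats false s)
changes+repeats false (true ∷ s)  = cong suc (changes+repeats true s)
changes+repeats false (false ∷ s) = trans (ℕ.+-suc _ _) (cong suc (changes+repeats false s))

-- Up to the last letter, which is its maximum, u behaves as it does
-- alone; that letter is then a peak, and m is none.
peaks-++ : ∀ p xs c m v → p < c → m < c → All (_< c) xs →
           countTriples isPeak p ((xs ∷ʳ c) ++ m ∷ v) ≡
           countTriples isPeak p (xs ∷ʳ c) ℕ.+ suc (countTriples isPeak m v)
peaks-++ p [] c m v p<c m<c [] rewrite <⇒<ᵇ p<c | <⇒<ᵇ m<c = cong suc (after v)
  where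
  after : ∀ v → countTriples isPeak c (m ∷ v) ≡ countTriples isPeak m v
  after []      = refl
  after (b ∷ v) rewrite >⇒≮ᵇ m<c = refl
peaks-++ p (x ∷ []) c m v p<c m<c (x<c ∷ []) =
  trans (cong (ind (isPeak p x c) ℕ.+_) (peaks-++ x [] c m v x<c m<c [])) (sym (ℕ.+-assoc (ind (isPeak p x c)) _ _))
peaks-++ p (x ∷ y ∷ xs) c m v p<c m<c (x<c ∷ xs<c) =
  trans (cong (ind (isPeak p x y) ℕ.+_) (peaks-++ x (y ∷ xs) c m v x<c m<c xs<c)) (sym (ℕ.+-assoc (ind (isPeak p x y)) _ _))

-- The letter before m could matter only for whether m is a peak, and m is followed by an ascent or
-- by nothing.
peaks-ascent : ∀ p m v → All (m <_) v → countTriples isPeak p (m ∷ v) ≡ countTriples isPeak m v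
peaks-ascent p m []      []          = refl
peaks-ascent p m (b ∷ v) (m<b ∷ _)
  rewrite >⇒≮ᵇ m<b with p <ᵇ m
... | true  = refl
... | false = refl

-- At a binary node the last letter of the left word becomes a peak. This additional peak supplies
-- the second 1 when the counts 1 + peaks of the two subtrees are added.
peaks-word : ∀ p {t} → All (p <_) (word t) → Increasing t → suc (countTriples isPeak p (word t)) ≡ leaves t
peaks-word p _ leaf = refl
peaks-word p (p<m ∷ p<v) (one {m} {v} m<v inc) =
  trans (cong suc (peaks-ascent p m (word v) m<v)) (peaks-word m m<v inc)
peaks-word p p<w (two {u} {m} {v} m<u m<v _ incᵤ incᵥ) = trans
  (cong suc (subst (λ w → countTriples isPeak p (w ++ m ∷ word v) ≡
                          countTriples isPeak p w ℕ.+ suc (countTriples isPeak m (word v)))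
    (sym (word≡initial∷ʳtop u))
    (peaks-++ p (initial u) (top u) m (word v) (All.lookup p<u (top∈word u)) (All.lookup m<u (top∈word u)) (initial<top incᵤ))))
  (cong₂ ℕ._+_ (peaks-word p p<u incᵤ) (peaks-word m m<v incᵥ))
  where p<u = All.++⁻ˡ (word u) p<w

steps-inserts : ∀ {M} a w → All (_< M) (a ∷ w) → map (stepsFrom a) (inserts M w) ≡ signatures (stepsFrom a w)
steps-inserts a []      (a<M ∷ []) rewrite <⇒<ᵇ a<M = refl
steps-inserts {M} a (b ∷ w) (a<M ∷ b<M ∷ w<M)
  rewrite <⇒<ᵇ a<M | >⇒≮ᵇ b<M = cong (_ ∷_) (begin
    map (stepsFrom a) (map (b ∷_) (inserts M w))         ≡⟨ List.map-∘ (inserts M w) ⟨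
    map (λ w′ → (a <ᵇ b) ∷ stepsFrom b w′) (inserts M w) ≡⟨ List.map-∘ (inserts M w) ⟩
    map ((a <ᵇ b) ∷_) (map (stepsFrom b) (inserts M w))  ≡⟨ cong (map _) (steps-inserts b w (b<M ∷ w<M)) ⟩
    map ((a <ᵇ b) ∷_) (signatures (stepsFrom b w))       ∎)
  where open ≡.≡-Reasoning

steps-inserts-all : ∀ {M} a w → All (_< M) (a ∷ w) →
                    map steps (inserts M (a ∷ w)) ≡ (false ∷ stepsFrom a w) ∷ signatures (stepsFrom a w)
steps-inserts-all {M} a w w<M@(a<M ∷ _) rewrite >⇒≮ᵇ a<M =
  cong (_ ∷_) (trans (sym (List.map-∘ (inserts M w))) (steps-inserts a w w<M))

leaves+inner : ∀ t → leaves t ℕ.+ inner t ≡ length (word t)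
leaves+inner (leaf m)    = refl
leaves+inner (one m v)   = trans (ℕ.+-suc _ _) (cong suc (leaves+inner v))
leaves+inner (two u m v) = begin
  (leaves u ℕ.+ leaves v) ℕ.+ suc (inner u ℕ.+ inner v)   ≡⟨ ℕ.+-suc _ _ ⟩
  suc ((leaves u ℕ.+ leaves v) ℕ.+ (inner u ℕ.+ inner v)) ≡⟨ cong suc (interchange (leaves u) _ _ _) ⟩
  suc ((leaves u ℕ.+ inner u) ℕ.+ (leaves v ℕ.+ inner v)) ≡⟨ cong suc (cong₂ ℕ._+_ (leaves+inner u) (leaves+inner v)) ⟩
  suc (length (word u) ℕ.+ length (word v))               ≡⟨ ℕ.+-suc _ _ ⟨
  length (word u) ℕ.+ length (m ∷ word v)                 ≡⟨ List.length-++ (word u) ⟨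
  length (word u ++ m ∷ word v)                           ∎
  where
  open ≡.≡-Reasoning
  open import Algebra.Properties.CommutativeSemigroup ℕ.+-commutativeSemigroup using (interchange)

inner-suc : ∀ {n t} → length (word t) ≡ suc (suc n) → ∃ λ N → inner t ≡ suc N
inner-suc {t = one m v}   _ = _ , refl
inner-suc {t = two u m v} _ = _ , refl

-- The homogeneous identity

module Identity (K : CommutativeRing 0ℓ 0ℓ) where
  open CommutativeRing K renaming (refl to ≈-refl; sym to ≈-sym; trans to ≈-trans) hiding (_-_)
  open InRing rawRing using (∑)
  open Weights K
  open import Algebra.Solver.Ring.NaturalCoefficients.Default commutativeSemiring
    using (solve; _:=_; _:+_; _:*_; con)
  open import Algebra.Properties.Monoid.Mult +-monoid using (×-homo-+)
  open import Relation.Binary.Reasoning.Setoid setoid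

  length-2+ : ∀ {w n} → w ↭ values (suc (suc n)) → ∃ λ a → ∃ λ b → ∃ λ w′ → w ≡ a ∷ b ∷ w′
  length-2+ {[]}        p with () ← ↭-length p
  length-2+ {_ ∷ []}    p with () ← ↭-length p
  length-2+ {_ ∷ _ ∷ _} p = _ , _ , _ , refl

  sum-inserts : ∀ g M a b w → All (_< M) (a ∷ b ∷ w) →
                sum (inserts M (a ∷ b ∷ w)) (runWeight g ∘ steps) ≈ runWeight (promote g) (steps (a ∷ b ∷ w))
  sum-inserts g M a b w w<M = begin
    sum (inserts M (a ∷ b ∷ w)) (runWeight g ∘ steps)
      ≈⟨ sum-map steps (inserts M (a ∷ b ∷ w)) (runWeight g) ⟨
    sum (map steps (inserts M (a ∷ b ∷ w))) (runWeight g)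
      ≈⟨ reflexive (cong (λ ss → sum ss (runWeight g)) (steps-inserts-all a (b ∷ w) w<M)) ⟩
    sum ((false ∷ stepsFrom a (b ∷ w)) ∷ signatures (stepsFrom a (b ∷ w))) (runWeight g)
      ≈⟨ sum-insertMax g (a <ᵇ b) (stepsFrom b w) ⟩
    runWeight (promote g) (steps (a ∷ b ∷ w)) ∎

  perms-trees : ∀ n g → sum (perms (2 ℕ.+ n)) (runWeight g ∘ steps) ≈
                ι 2 * sum (trees (2 ℕ.+ n)) (λ t → treeWeight g (leaves t) (inner t))
  perms-trees zero    g =
    -- The words 21 and 12 have one run each, while the only tree has one leaf and one inner node:
    -- this is the origin of the factor 2.
    solve 1 (λ a → a :+ (a :+ con 0) := (con 1 :+ (con 1 :+ con 0)) :* (a :+ con 0)) ≈-refl (g 1 0)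
  perms-trees (suc n) g = begin
    sum (perms (3 ℕ.+ n)) (runWeight g ∘ steps)
      ≈⟨ sum-concatMap (inserts (3 ℕ.+ n)) (perms (2 ℕ.+ n)) _ ⟩
    sum (perms (2 ℕ.+ n)) (λ w → sum (inserts (3 ℕ.+ n) w) (runWeight g ∘ steps))
      ≈⟨ sum-cong (perms (2 ℕ.+ n)) (All.map insertion (perms-sound (2 ℕ.+ n))) ⟩
    sum (perms (2 ℕ.+ n)) (runWeight (promote g) ∘ steps)
      ≈⟨ perms-trees n (promote g) ⟩
    ι 2 * sum (trees (2 ℕ.+ n)) (λ t → treeWeight (promote g) (leaves t) (inner t))
      ≈⟨ *-congˡ (sum-cong (trees (2 ℕ.+ n)) (All.map growth (trees-sound (2 ℕ.+ n)))) ⟨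
    ι 2 * sum (trees (2 ℕ.+ n)) (λ t → sum (grow (3 ℕ.+ n) t) (λ t → treeWeight g (leaves t) (inner t)))
      ≈⟨ *-congˡ (sum-concatMap (grow (3 ℕ.+ n)) (trees (2 ℕ.+ n)) _) ⟨
    ι 2 * sum (trees (3 ℕ.+ n)) (λ t → treeWeight g (leaves t) (inner t)) ∎
    where
    insertion : ∀ {w} → w ↭ values (2 ℕ.+ n) →
                sum (inserts (3 ℕ.+ n) w) (runWeight g ∘ steps) ≈ runWeight (promote g) (steps w)
    insertion p with a , b , w , refl ← length-2+ p =
      sum-inserts g _ a b w (All-resp-↭ (↭-sym p) (values< (2 ℕ.+ n)))

    growth : ∀ {t} → Increasing t × word t ↭ values (2 ℕ.+ n) →
             sum (grow (3 ℕ.+ n) t) (λ t → treeWeight g (leaves t) (inner t)) ≈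
             treeWeight (promote g) (leaves t) (inner t)
    growth {t} (_ , p)
      with N , eq ← inner-suc {t = t} (trans (↭-length p) (List.length-applyDownFrom suc (2 ℕ.+ n)))
      = sum-grow-treeWeight _ t N g eq

  sum-zero : ∀ {A : Set} (xs : List A) {f : A → Carrier} → (∀ x → f x ≈ 0#) → sum xs f ≈ 0#
  sum-zero []       f≈0 = ≈-refl
  sum-zero (x ∷ xs) f≈0 = ≈-trans (+-cong (f≈0 x) (sum-zero xs f≈0)) (+-identityʳ 0#)

  sum-+ : ∀ {A : Set} (xs : List A) f g → sum xs (λ x → f x + g x) ≈ sum xs f + sum xs g
  sum-+ []       f g = ≈-sym (+-identityʳ 0#)
  sum-+ (x ∷ xs) f g = ≈-trans (+-congˡ (sum-+ xs f g))
    (solve 4 (λ a b c d → (a :+ b) :+ (c :+ d) := (a :+ c) :+ (b :+ d)) ≈-refl _ _ _ _)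

  sum-single : ∀ {j m} → j < m → (φ : ℕ → ℕ) (f : ℕ → Carrier) → (∀ i → i ≢ j → f (φ i) ≈ 0#) →
               sum (applyUpTo φ m) f ≈ f (φ j)
  sum-single {zero}  {suc m} _ φ f f≈0 =
    ≈-trans (+-congˡ (zeros m (φ ∘ suc) (λ i → f≈0 (suc i) λ ()))) (+-identityʳ _)
    where
    zeros : ∀ m (φ : ℕ → ℕ) → (∀ i → f (φ i) ≈ 0#) → sum (applyUpTo φ m) f ≈ 0#
    zeros zero    φ f≈0 = ≈-refl
    zeros (suc m) φ f≈0 = ≈-trans (+-cong (f≈0 0) (zeros m (φ ∘ suc) (f≈0 ∘ suc))) (+-identityʳ 0#)
  sum-single {suc j} {suc m} (s≤s j<m) φ f f≈0 =
    ≈-trans (+-cong (f≈0 0 λ ()) (sum-single j<m (φ ∘ suc) f (λ i i≢j → f≈0 (suc i) (i≢j ∘ ℕ.suc-injective))))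
            (+-identityˡ _)

  -- Turns a polynomial given by counts into a sum over the objects counted. Each object x
  -- contributes a Kronecker delta `δ`, and the bound m ensures that its index `suc (v x)` occurs in
  -- the interval.
  sum-by-value : ∀ {A : Set} (v : A → ℕ) m (h : ℕ → Carrier) xs → All (λ x → v x < m) xs →
                 ∑ (interval 1 m) (λ k → count (λ x → suc (v x) ℕ.≟ k) xs · h k) ≈ sum xs (h ∘ suc ∘ v)
  sum-by-value v m h []       []           = sum-zero (interval 1 m) (λ _ → ≈-refl)
  sum-by-value v m h (x ∷ xs) (vx<m ∷ vxs<m) = begin
    sum (interval 1 m) (λ k → count (λ x → suc (v x) ℕ.≟ k) (x ∷ xs) · h k)
      ≈⟨ sum-cong (interval 1 m) (All.universal (λ k → ≈-trans
           (reflexive (cong (_· h k) (count-∷ (λ x → suc (v x) ℕ.≟ k) x xs)))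
           (×-homo-+ (h k) (δ k) (count (λ x → suc (v x) ℕ.≟ k) xs))) (interval 1 m)) ⟩
    sum (interval 1 m) (λ k → δ k · h k + count (λ x → suc (v x) ℕ.≟ k) xs · h k)
      ≈⟨ sum-+ (interval 1 m) _ _ ⟩
    sum (interval 1 m) (λ k → δ k · h k) + sum (interval 1 m) (λ k → count (λ x → suc (v x) ℕ.≟ k) xs · h k)
      ≈⟨ +-cong (≈-trans (sum-single vx<m suc (λ k → δ k · h k) off) on) (sum-by-value v m h xs vxs<m) ⟩
    h (suc (v x)) + sum xs (h ∘ suc ∘ v) ∎
    where
    δ : ℕ → ℕ
    δ k = ind (does (suc (v x) ℕ.≟ k))

    off : ∀ i → i ≢ v x → δ (suc i) · h (suc i) ≈ 0#
    off i i≢ rewrite dec-false (suc (v x) ℕ.≟ suc i) (i≢ ∘ sym ∘ ℕ.suc-injective) = ≈-refl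

    on : δ (suc (v x)) · h (suc (v x)) ≈ h (suc (v x))
    on rewrite dec-true (suc (v x) ℕ.≟ suc (v x)) refl = +-identityʳ _

  -- Of the 1 + n steps of the word, all but the first are either a change or a repeat, so the
  -- exponent obtained by subtraction is the number of repeats.
  runWeight-toWord : ∀ {n} (g : Weight) (π : Vec (Fin (2 ℕ.+ n)) (2 ℕ.+ n)) → π ∈ 𝔖 (2 ℕ.+ n) →
                     g (alternatingRuns π) (suc n ∸ alternatingRuns π) ≡ runWeight g (steps (toWord π))
  runWeight-toWord {n} g (a ∷ b ∷ π) π∈ = cong₂ g (cong suc eq) (trans (cong (n ∸_) eq) repeats≡)
    where
    p = suc (toℕ a) <ᵇ suc (toℕ b)
    s = stepsFrom (suc (toℕ b)) (toWord π)

    eq : directionChanges (a ∷ b ∷ π) ≡ changes p s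
    eq = trans (directionChanges≡ a (b ∷ π)) (turns≡changes _ _ (toWord π)
           (Unique-resp-↭ (↭-sym (toWord-↭-values π∈)) (values-unique (2 ℕ.+ n))))

    repeats≡ : n ∸ changes p s ≡ repeats p s
    repeats≡ = trans (cong (_∸ changes p s) (trans (sym (trans (length-stepsFrom _ (toWord π)) (length-toWord π)))
                 (sym (changes+repeats p s)))) (ℕ.m+n∸m≡n (changes p s) _)

  sum-R : ∀ n (g : Weight) → ∑ (interval 1 (suc n)) (λ k → r (2 ℕ.+ n) k · g k (suc n ∸ k)) ≈
          sum (perms (2 ℕ.+ n)) (runWeight g ∘ steps)
  sum-R n g = begin
    ∑ (interval 1 (suc n)) (λ k → r (2 ℕ.+ n) k · g k (suc n ∸ k))
      ≈⟨ sum-by-value directionChanges (suc n) (λ k → g k (suc n ∸ k)) (𝔖 (2 ℕ.+ n))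
           (All.universal (λ π → s≤s (few π)) _) ⟩
    sum (𝔖 (2 ℕ.+ n)) (λ π → g (alternatingRuns π) (suc n ∸ alternatingRuns π))
      ≈⟨ sum-cong (𝔖 (2 ℕ.+ n)) (All.tabulate (λ {π} π∈ → reflexive (runWeight-toWord g π π∈))) ⟩
    sum (𝔖 (2 ℕ.+ n)) (runWeight g ∘ steps ∘ toWord)
      ≈⟨ sum-map toWord (𝔖 (2 ℕ.+ n)) _ ⟨
    sum (map toWord (𝔖 (2 ℕ.+ n))) (runWeight g ∘ steps)
      ≈⟨ sum-↭ _ (𝔖↭perms (2 ℕ.+ n)) ⟩
    sum (perms (2 ℕ.+ n)) (runWeight g ∘ steps) ∎
    where
    few : ∀ (π : Vec (Fin (2 ℕ.+ n)) (2 ℕ.+ n)) → directionChanges π ≤ n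
    few π = ℕ.≤-trans (List.length-filter _ (interval 2 (suc n))) (ℕ.≤-reflexive (List.length-applyUpTo _ n))

  sum-D : ∀ n h → ∑ (interval 1 (suc n)) (λ k → d (suc n) k · h k) ≈ sum (trees (suc n)) (h ∘ leaves)
  sum-D n h = begin
    ∑ (interval 1 (suc n)) (λ k → d (suc n) k · h k)
      ≈⟨ sum-by-value leftPeaks (suc n) h (𝔄 (suc n)) (All.universal (λ π → s≤s (few π)) _) ⟩
    sum (𝔄 (suc n)) (h ∘ suc ∘ leftPeaks)
      ≈⟨ sum-cong (𝔄 (suc n)) (All.universal (λ π → reflexive (cong (h ∘ suc) (leftPeaks≡ π))) _) ⟩
    sum (𝔄 (suc n)) (h ∘ suc ∘ countTriples isPeak 0 ∘ toWord)
      ≈⟨ sum-map toWord (𝔄 (suc n)) _ ⟨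
    sum (map toWord (𝔄 (suc n))) (h ∘ suc ∘ countTriples isPeak 0)
      ≈⟨ sum-↭ _ (𝔄↭trees n) ⟩
    sum (map word (trees (suc n))) (h ∘ suc ∘ countTriples isPeak 0)
      ≈⟨ sum-map word (trees (suc n)) _ ⟩
    sum (trees (suc n)) (h ∘ suc ∘ countTriples isPeak 0 ∘ word)
      ≈⟨ sum-cong (trees (suc n)) (All.map (λ (inc , p) → reflexive (cong h
           (peaks-word 0 (All-resp-↭ (↭-sym p) (All.applyDownFrom⁺₁ suc (suc n) (λ _ → s≤s z≤n))) inc))) (trees-sound (suc n))) ⟩
    sum (trees (suc n)) (h ∘ leaves) ∎
    where
    few : ∀ (π : Vec (Fin (suc n)) (suc n)) → leftPeaks π ≤ n
    few π = ℕ.≤-trans (List.length-filter (peak? π) (interval 1 n)) (ℕ.≤-reflexive (List.length-applyUpTo suc n))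

  evaluate-monomial : ∀ N x y k j → evaluate N (λ i j → x ^ i * y ^ j) k j ≈ x ^ k * y ^ j * (x + y) ^ N
  evaluate-monomial zero    x y k j = ≈-sym (*-identityʳ _)
  evaluate-monomial (suc N) x y k j = ≈-trans
    (+-cong (evaluate-monomial N x y (suc k) j) (evaluate-monomial N x y k (suc j)))
    (solve 5 (λ x y a b c → (x :* a) :* b :* c :+ a :* (y :* b) :* c := a :* b :* ((x :+ y) :* c)) ≈-refl x y _ _ _)

  treeWeight-monomial : ∀ {n t} x y → word t ↭ values (2 ℕ.+ n) →
    treeWeight (λ i j → x ^ i * y ^ j) (leaves t) (inner t) ≈ x ^ leaves t * (x + y) ^ (suc n ∸ leaves t)
  treeWeight-monomial {n} {t} x y p
    with |w| ← trans (↭-length p) (List.length-applyDownFrom suc (2 ℕ.+ n))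
    with N , eq ← inner-suc {t = t} |w| = begin
    treeWeight g k (inner t)              ≈⟨ reflexive (cong (treeWeight g k) eq) ⟩
    evaluate N g k 0                      ≈⟨ evaluate-monomial N x y k 0 ⟩
    x ^ k * 1# * (x + y) ^ N              ≈⟨ *-cong (*-identityʳ _) (reflexive (cong ((x + y) ^_) N≡)) ⟩
    x ^ k * (x + y) ^ (suc n ∸ k)         ∎
    where
    k = leaves t
    g : Weight
    g i j = x ^ i * y ^ j
    N≡ : N ≡ suc n ∸ k
    N≡ = trans (sym (ℕ.m+n∸m≡n k N)) (cong (_∸ k) (ℕ.suc-injective
           (trans (sym (ℕ.+-suc k N)) (trans (cong (k ℕ.+_) (sym eq)) (trans (leaves+inner t) |w|)))))

  homogeneous : ∀ n x y →
    ∑ (interval 1 (suc n)) (λ k → r (2 ℕ.+ n) k · (x ^ k * y ^ (suc n ∸ k))) ≈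
    2 · sum (trees (2 ℕ.+ n)) (λ t → x ^ leaves t * (x + y) ^ (suc n ∸ leaves t))
  homogeneous n x y = begin
    ∑ (interval 1 (suc n)) (λ k → r (2 ℕ.+ n) k · (x ^ k * y ^ (suc n ∸ k)))
      ≈⟨ sum-R n g ⟩
    sum (perms (2 ℕ.+ n)) (runWeight g ∘ steps)
      ≈⟨ perms-trees n g ⟩
    ι 2 * sum (trees (2 ℕ.+ n)) (λ t → treeWeight g (leaves t) (inner t))
      ≈⟨ *-congˡ (sum-cong (trees (2 ℕ.+ n)) (All.map (λ {t} (_ , p) → treeWeight-monomial {t = t} x y p) (trees-sound (2 ℕ.+ n)))) ⟩
    ι 2 * sum (trees (2 ℕ.+ n)) (λ t → x ^ leaves t * (x + y) ^ (suc n ∸ leaves t))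
      ≈⟨ solve 1 (λ a → (con 1 :+ (con 1 :+ con 0)) :* a := a :+ (a :+ con 0)) ≈-refl _ ⟩
    2 · sum (trees (2 ℕ.+ n)) (λ t → x ^ leaves t * (x + y) ^ (suc n ∸ leaves t)) ∎
    where
    g : Weight
    g i j = x ^ i * y ^ j

-- The two specialisations

module Specialise (K : CommutativeRing 0ℓ 0ℓ) where
  open CommutativeRing K renaming (refl to ≈-refl; sym to ≈-sym; trans to ≈-trans) hiding (_-_)
  open InRing rawRing using (∑; R; D; _-_)
  open Weights K
  open Identity K
  open import Algebra.Solver.Ring.NaturalCoefficients.Default commutativeSemiring
    using (solve; _:=_; _:+_; _:*_; con)
  open import Algebra.Properties.Monoid.Mult +-monoid using (×-congʳ)
  open import Relation.Binary.Reasoning.Setoid setoid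

  ^-congˡ : ∀ {x y} n → x ≈ y → x ^ n ≈ y ^ n
  ^-congˡ zero    x≈y = ≈-refl
  ^-congˡ (suc n) x≈y = *-cong x≈y (^-congˡ n x≈y)

  1^ : ∀ n → 1# ^ n ≈ 1#
  1^ zero    = ≈-refl
  1^ (suc n) = ≈-trans (*-identityˡ _) (1^ n)

  -- The element h stands for one half, so that the division by 2 can be stated in a commutative
  -- ring. With y = 1 - x every power of x + y in the tree sum collapses to 1.
  D-from-R : ∀ n h x → h * (2 · 1#) ≈ 1# →
    D (2 ℕ.+ n) x ≈ h * ∑ (interval 1 (suc n)) (λ k → r (2 ℕ.+ n) k · (x ^ k * (1# - x) ^ (suc n ∸ k)))
  D-from-R n h x h*2≈1 = begin
    D (2 ℕ.+ n) x
      ≈⟨ sum-D (suc n) (x ^_) ⟩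
    sum (trees (2 ℕ.+ n)) (λ t → x ^ leaves t)
      ≈⟨ sum-cong (trees (2 ℕ.+ n)) (All.universal (λ t → ≈-trans
           (*-congˡ (≈-trans (^-congˡ (suc n ∸ leaves t) x+[1-x]≈1) (1^ (suc n ∸ leaves t)))) (*-identityʳ _)) _) ⟨
    T ≈⟨ *-identityˡ T ⟨
    1# * T
      ≈⟨ *-congʳ h*2≈1 ⟨
    h * (2 · 1#) * T
      ≈⟨ solve 2 (λ h t → h :* (con 1 :+ (con 1 :+ con 0)) :* t := h :* (t :+ (t :+ con 0))) ≈-refl h T ⟩
    h * (2 · T)
      ≈⟨ *-congˡ (homogeneous n x (1# - x)) ⟨
    h * ∑ (interval 1 (suc n)) (λ k → r (2 ℕ.+ n) k · (x ^ k * (1# - x) ^ (suc n ∸ k))) ∎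
    where
    T = sum (trees (2 ℕ.+ n)) (λ t → x ^ leaves t * (x + (1# - x)) ^ (suc n ∸ leaves t))

    x+[1-x]≈1 : x + (1# - x) ≈ 1#
    x+[1-x]≈1 = begin
      x + (1# + (- x))   ≈⟨ solve 3 (λ x y z → x :+ (y :+ z) := y :+ (x :+ z)) ≈-refl x 1# (- x) ⟩
      1# + (x + (- x))   ≈⟨ +-congˡ (-‿inverseʳ x) ⟩
      1# + 0#            ≈⟨ +-identityʳ 1# ⟩
      1#                 ∎

  -- The element z stands for x/(1 + x), given by the equation it satisfies. Each tree with k leaves
  -- uses up k of the n + 1 factors 1 + x to turn zᵏ into xᵏ, and the remaining ones are the power
  -- of x + y at y = 1.
  R-from-D : ∀ n x z → z * (1# + x) ≈ x →
    R (2 ℕ.+ n) x ≈ 2 · ((1# + x) ^ suc n * D (2 ℕ.+ n) z)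
  R-from-D n x z z*[1+x]≈x = begin
    R (2 ℕ.+ n) x
      ≈⟨ sum-cong (interval 1 (suc n)) (All.universal (λ k → ×-congʳ (r (2 ℕ.+ n) k)
           (≈-trans (*-congˡ (1^ (suc n ∸ k))) (*-identityʳ (x ^ k)))) _) ⟨
    ∑ (interval 1 (suc n)) (λ k → r (2 ℕ.+ n) k · (x ^ k * 1# ^ (suc n ∸ k)))
      ≈⟨ homogeneous n x 1# ⟩
    2 · sum (trees (2 ℕ.+ n)) (λ t → x ^ leaves t * (x + 1#) ^ (suc n ∸ leaves t))
      ≈⟨ ×-congʳ 2 (sum-cong (trees (2 ℕ.+ n)) (All.map (λ {t} (_ , p) → term {t} p) (trees-sound (2 ℕ.+ n)))) ⟨
    2 · sum (trees (2 ℕ.+ n)) (λ t → (1# + x) ^ suc n * z ^ leaves t)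
      ≈⟨ ×-congʳ 2 (sum-*ˡ ((1# + x) ^ suc n) (trees (2 ℕ.+ n)) _) ⟨
    2 · ((1# + x) ^ suc n * sum (trees (2 ℕ.+ n)) (λ t → z ^ leaves t))
      ≈⟨ ×-congʳ 2 (*-congˡ (sum-D (suc n) (z ^_))) ⟨
    2 · ((1# + x) ^ suc n * D (2 ℕ.+ n) z) ∎
    where
    clear : ∀ k m → (1# + x) ^ (k ℕ.+ m) * z ^ k ≈ x ^ k * (x + 1#) ^ m
    clear zero    m = ≈-trans (*-comm _ _) (*-congˡ (^-congˡ m (+-comm 1# x)))
    clear (suc k) m = begin
      (1# + x) * (1# + x) ^ (k ℕ.+ m) * (z * z ^ k)
        ≈⟨ solve 4 (λ y a z b → y :* a :* (z :* b) := z :* y :* (a :* b)) ≈-refl (1# + x) _ z _ ⟩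
      z * (1# + x) * ((1# + x) ^ (k ℕ.+ m) * z ^ k)
        ≈⟨ *-cong z*[1+x]≈x (clear k m) ⟩
      x * (x ^ k * (x + 1#) ^ m)
        ≈⟨ *-assoc _ _ _ ⟨
      x * x ^ k * (x + 1#) ^ m ∎

    term : ∀ {t} → word t ↭ values (2 ℕ.+ n) →
           (1# + x) ^ suc n * z ^ leaves t ≈ x ^ leaves t * (x + 1#) ^ (suc n ∸ leaves t)
    term {t} p = ≈-trans
      (*-congʳ (reflexive (cong ((1# + x) ^_) (sym (ℕ.m+[n∸m]≡n leaves≤)))))
      (clear (leaves t) (suc n ∸ leaves t))
      where
      |w| = trans (↭-length p) (List.length-applyDownFrom suc (2 ℕ.+ n))

      -- There are 2 + n nodes, at least one of them inner. The bound makes the truncated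
      -- subtraction in the exponent exact.
      leaves≤ : leaves t ≤ suc n
      leaves≤ with N , eq ← inner-suc {t = t} |w| = subst (leaves t ≤_)
        (ℕ.suc-injective (trans (sym (ℕ.+-suc _ N)) (trans (cong (leaves t ℕ.+_) (sym eq)) (trans (leaves+inner t) |w|))))
        (ℕ.m≤m+n (leaves t) N)

-- The rings ℚ[x] and ℚ(x)

coeff-neg : ∀ p i → coeff (-ₚ p) i ≡ ℚ.- coeff p i
coeff-neg []      i       = refl
coeff-neg (a ∷ p) zero    = refl
coeff-neg (a ∷ p) (suc i) = coeff-neg p i

*ₚ-congˡ : ∀ p {q r} → q ≈ₚ r → p *ₚ q ≈ₚ p *ₚ r
*ₚ-congˡ []      q≈r i       = refl
*ₚ-congˡ (a ∷ p) {q} {r} q≈r zero    =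
  trans (coeff-*-zero a p q) (trans (cong (a ℚ.*_) (q≈r 0)) (sym (coeff-*-zero a p r)))
*ₚ-congˡ (a ∷ p) {q} {r} q≈r (suc i) =
  trans (coeff-*-suc a p q i)
    (trans (cong₂ ℚ._+_ (cong (a ℚ.*_) (q≈r (suc i))) (*ₚ-congˡ p q≈r i)) (sym (coeff-*-suc a p r i)))

*ₚ-[] : ∀ p → p *ₚ [] ≈ₚ []
*ₚ-[] []      i       = refl
*ₚ-[] (a ∷ p) zero    = refl
*ₚ-[] (a ∷ p) (suc i) = *ₚ-[] p i

-- Multiplication recurses on its left factor; this and the next lemma give the mirrored recursion
-- on the right factor, from which commutativity follows.
*ₚ-∷-zero : ∀ p b q → coeff (p *ₚ (b ∷ q)) 0 ≡ b ℚ.* coeff p 0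
*ₚ-∷-zero []      b q = sym (ℚ.*-zeroʳ b)
*ₚ-∷-zero (a ∷ p) b q = trans (coeff-*-zero a p (b ∷ q)) (ℚ.*-comm a b)

*ₚ-∷-suc : ∀ p b q i → coeff (p *ₚ (b ∷ q)) (suc i) ≡ b ℚ.* coeff p (suc i) ℚ.+ coeff (p *ₚ q) i
*ₚ-∷-suc []      b q i       = sym (trans (ℚ.+-identityʳ _) (ℚ.*-zeroʳ b))
*ₚ-∷-suc (a ∷ p) b q zero    = begin
  coeff ((a ∷ p) *ₚ (b ∷ q)) 1                ≡⟨ coeff-*-suc a p (b ∷ q) 0 ⟩
  a ℚ.* coeff q 0 ℚ.+ coeff (p *ₚ (b ∷ q)) 0  ≡⟨ cong (a ℚ.* coeff q 0 ℚ.+_) (*ₚ-∷-zero p b q) ⟩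
  a ℚ.* coeff q 0 ℚ.+ b ℚ.* coeff p 0         ≡⟨ ℚ.+-comm (a ℚ.* coeff q 0) _ ⟩
  b ℚ.* coeff p 0 ℚ.+ a ℚ.* coeff q 0         ≡⟨ cong (b ℚ.* coeff p 0 ℚ.+_) (coeff-*-zero a p q) ⟨
  b ℚ.* coeff p 0 ℚ.+ coeff ((a ∷ p) *ₚ q) 0  ∎
  where open ≡.≡-Reasoning
*ₚ-∷-suc (a ∷ p) b q (suc i) = begin
  coeff ((a ∷ p) *ₚ (b ∷ q)) (2 ℕ.+ i)
    ≡⟨ coeff-*-suc a p (b ∷ q) (suc i) ⟩
  a ℚ.* coeff q (suc i) ℚ.+ coeff (p *ₚ (b ∷ q)) (suc i)
    ≡⟨ cong (a ℚ.* coeff q (suc i) ℚ.+_) (*ₚ-∷-suc p b q i) ⟩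
  a ℚ.* coeff q (suc i) ℚ.+ (b ℚ.* coeff p (suc i) ℚ.+ coeff (p *ₚ q) i)
    ≡⟨ solve 3 (λ x y z → x :+ (y :+ z) := y :+ (x :+ z)) refl (a ℚ.* coeff q (suc i)) (b ℚ.* coeff p (suc i)) (coeff (p *ₚ q) i) ⟩
  b ℚ.* coeff p (suc i) ℚ.+ (a ℚ.* coeff q (suc i) ℚ.+ coeff (p *ₚ q) i)
    ≡⟨ cong (b ℚ.* coeff p (suc i) ℚ.+_) (coeff-*-suc a p q i) ⟨
  b ℚ.* coeff p (suc i) ℚ.+ coeff ((a ∷ p) *ₚ q) (suc i) ∎
  where open ≡.≡-Reasoning
        open ℚ.+-*-Solver

*ₚ-comm : ∀ p q → p *ₚ q ≈ₚ q *ₚ p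
*ₚ-comm []      q i       = sym (*ₚ-[] q i)
*ₚ-comm (a ∷ p) q zero    = trans (coeff-*-zero a p q) (sym (*ₚ-∷-zero q a p))
*ₚ-comm (a ∷ p) q (suc i) = trans (coeff-*-suc a p q i)
  (trans (cong (a ℚ.* coeff q (suc i) ℚ.+_) (*ₚ-comm p q i)) (sym (*ₚ-∷-suc q a p i)))

*ₚ-distribˡ : ∀ p q r → p *ₚ (q +ₚ r) ≈ₚ p *ₚ q +ₚ p *ₚ r
*ₚ-distribˡ []      q r i       = refl
*ₚ-distribˡ (a ∷ p) q r zero    = begin
  coeff ((a ∷ p) *ₚ (q +ₚ r)) 0                        ≡⟨ coeff-*-zero a p (q +ₚ r) ⟩
  a ℚ.* coeff (q +ₚ r) 0                               ≡⟨ cong (a ℚ.*_) (coeff-+ q r 0) ⟩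
  a ℚ.* (coeff q 0 ℚ.+ coeff r 0)                      ≡⟨ ℚ.*-distribˡ-+ a _ _ ⟩
  a ℚ.* coeff q 0 ℚ.+ a ℚ.* coeff r 0                  ≡⟨ cong₂ ℚ._+_ (coeff-*-zero a p q) (coeff-*-zero a p r) ⟨
  coeff ((a ∷ p) *ₚ q) 0 ℚ.+ coeff ((a ∷ p) *ₚ r) 0    ≡⟨ coeff-+ ((a ∷ p) *ₚ q) _ 0 ⟨
  coeff ((a ∷ p) *ₚ q +ₚ (a ∷ p) *ₚ r) 0               ∎
  where open ≡.≡-Reasoning
*ₚ-distribˡ (a ∷ p) q r (suc i) = begin
  coeff ((a ∷ p) *ₚ (q +ₚ r)) (suc i)
    ≡⟨ coeff-*-suc a p (q +ₚ r) i ⟩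
  a ℚ.* coeff (q +ₚ r) (suc i) ℚ.+ coeff (p *ₚ (q +ₚ r)) i
    ≡⟨ cong₂ (λ x y → a ℚ.* x ℚ.+ y) (coeff-+ q r (suc i)) (trans (*ₚ-distribˡ p q r i) (coeff-+ (p *ₚ q) _ i)) ⟩
  a ℚ.* (coeff q (suc i) ℚ.+ coeff r (suc i)) ℚ.+ (coeff (p *ₚ q) i ℚ.+ coeff (p *ₚ r) i)
    ≡⟨ solve 5 (λ a x y z w → a :* (x :+ y) :+ (z :+ w) := (a :* x :+ z) :+ (a :* y :+ w)) refl a (coeff q (suc i)) (coeff r (suc i)) (coeff (p *ₚ q) i) (coeff (p *ₚ r) i) ⟩
  (a ℚ.* coeff q (suc i) ℚ.+ coeff (p *ₚ q) i) ℚ.+ (a ℚ.* coeff r (suc i) ℚ.+ coeff (p *ₚ r) i)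
    ≡⟨ cong₂ ℚ._+_ (coeff-*-suc a p q i) (coeff-*-suc a p r i) ⟨
  coeff ((a ∷ p) *ₚ q) (suc i) ℚ.+ coeff ((a ∷ p) *ₚ r) (suc i)
    ≡⟨ coeff-+ ((a ∷ p) *ₚ q) _ (suc i) ⟨
  coeff ((a ∷ p) *ₚ q +ₚ (a ∷ p) *ₚ r) (suc i) ∎
  where open ≡.≡-Reasoning
        open ℚ.+-*-Solver

+ₚ-cong : ∀ {p q r s} → p ≈ₚ q → r ≈ₚ s → p +ₚ r ≈ₚ q +ₚ s
+ₚ-cong {p} {q} {r} {s} p≈q r≈s i =
  trans (coeff-+ p r i) (trans (cong₂ ℚ._+_ (p≈q i) (r≈s i)) (sym (coeff-+ q s i)))

*ₚ-cong : ∀ {p q r s} → p ≈ₚ q → r ≈ₚ s → p *ₚ r ≈ₚ q *ₚ s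
*ₚ-cong {p} {q} {r} {s} p≈q r≈s i =
  trans (*ₚ-congˡ p r≈s i) (trans (*ₚ-comm p s i) (trans (*ₚ-congˡ s p≈q i) (*ₚ-comm s q i)))

*ₚ-distribʳ : ∀ p q r → (q +ₚ r) *ₚ p ≈ₚ q *ₚ p +ₚ r *ₚ p
*ₚ-distribʳ p q r i = trans (*ₚ-comm (q +ₚ r) p i)
  (trans (*ₚ-distribˡ p q r i) (+ₚ-cong {p *ₚ q} {q *ₚ p} {p *ₚ r} (*ₚ-comm p q) (*ₚ-comm p r) i))

scale-*ₚ : ∀ a p q i → coeff (map (a ℚ.*_) p *ₚ q) i ≡ a ℚ.* coeff (p *ₚ q) i
scale-*ₚ a []      q i       = sym (ℚ.*-zeroʳ a)
scale-*ₚ a (b ∷ p) q zero    = trans (coeff-*-zero (a ℚ.* b) (map (a ℚ.*_) p) q)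
  (trans (ℚ.*-assoc a b _) (cong (a ℚ.*_) (sym (coeff-*-zero b p q))))
scale-*ₚ a (b ∷ p) q (suc i) = begin
  coeff (map (a ℚ.*_) (b ∷ p) *ₚ q) (suc i)
    ≡⟨ coeff-*-suc (a ℚ.* b) (map (a ℚ.*_) p) q i ⟩
  a ℚ.* b ℚ.* coeff q (suc i) ℚ.+ coeff (map (a ℚ.*_) p *ₚ q) i
    ≡⟨ cong (a ℚ.* b ℚ.* coeff q (suc i) ℚ.+_) (scale-*ₚ a p q i) ⟩
  a ℚ.* b ℚ.* coeff q (suc i) ℚ.+ a ℚ.* coeff (p *ₚ q) i
    ≡⟨ solve 4 (λ a b x y → a :* b :* x :+ a :* y := a :* (b :* x :+ y)) refl a b (coeff q (suc i)) (coeff (p *ₚ q) i) ⟩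
  a ℚ.* (b ℚ.* coeff q (suc i) ℚ.+ coeff (p *ₚ q) i)
    ≡⟨ cong (a ℚ.*_) (coeff-*-suc b p q i) ⟨
  a ℚ.* coeff ((b ∷ p) *ₚ q) (suc i) ∎
  where open ≡.≡-Reasoning
        open ℚ.+-*-Solver

*ₚ-assoc : ∀ p q r → (p *ₚ q) *ₚ r ≈ₚ p *ₚ (q *ₚ r)
*ₚ-assoc []      q r i = refl
*ₚ-assoc (a ∷ p) q r i = trans (*ₚ-distribʳ r (map (a ℚ.*_) q) (0ℚ ∷ p *ₚ q) i)
  (trans (coeff-+ (map (a ℚ.*_) q *ₚ r) _ i) (split i))
  where
  split : ∀ i → coeff (map (a ℚ.*_) q *ₚ r) i ℚ.+ coeff ((0ℚ ∷ p *ₚ q) *ₚ r) i ≡ coeff ((a ∷ p) *ₚ (q *ₚ r)) i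
  split zero    = trans
    (cong₂ ℚ._+_ (scale-*ₚ a q r 0) (trans (coeff-*-zero 0ℚ (p *ₚ q) r) (ℚ.*-zeroˡ (coeff r 0))))
    (trans (ℚ.+-identityʳ _) (sym (coeff-*-zero a p (q *ₚ r))))
  split (suc i) = trans
    (cong₂ ℚ._+_ (scale-*ₚ a q r (suc i))
      (trans (coeff-*-suc 0ℚ (p *ₚ q) r i)
        (trans (cong (ℚ._+ coeff ((p *ₚ q) *ₚ r) i) (ℚ.*-zeroˡ (coeff r (suc i)))) (trans (ℚ.+-identityˡ _) (*ₚ-assoc p q r i)))))
    (sym (coeff-*-suc a p (q *ₚ r) i))

*ₚ-identityˡ : ∀ p → const 1ℚ *ₚ p ≈ₚ p
*ₚ-identityˡ p zero    = trans (coeff-*-zero 1ℚ [] p) (ℚ.*-identityˡ _)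
*ₚ-identityˡ p (suc i) = trans (coeff-*-suc 1ℚ [] p i) (trans (ℚ.+-identityʳ _) (ℚ.*-identityˡ _))

polynomialRing : CommutativeRing 0ℓ 0ℓ
polynomialRing = record
  { RawRing ℚ[x]
  ; isCommutativeRing = record
    { isRing = record
      { +-isAbelianGroup = record
        { isGroup = record
          { isMonoid = record
            { isSemigroup = record
              { isMagma = record
                { isEquivalence = record
                  { refl  = λ i → refl
                  ; sym   = λ p≈q i → sym (p≈q i)
                  ; trans = λ p≈q q≈r i → trans (p≈q i) (q≈r i)
                  }
                ; ∙-cong = λ {p} {q} {r} {s} → +ₚ-cong {p} {q} {r} {s}
                }
              ; assoc = assoc
              }
            ; identity = (λ p i → refl) , λ p i → trans (coeff-+ p [] i) (ℚ.+-identityʳ _)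
            }
          ; inverse = (λ p i → trans (coeff-+ (-ₚ p) p i) (trans (cong (ℚ._+ coeff p i) (coeff-neg p i)) (ℚ.+-inverseˡ (coeff p i))))
                    , (λ p i → trans (coeff-+ p (-ₚ p) i) (trans (cong (coeff p i ℚ.+_) (coeff-neg p i)) (ℚ.+-inverseʳ (coeff p i))))
          ; ⁻¹-cong = λ {p} {q} p≈q i → trans (coeff-neg p i) (trans (cong ℚ.-_ (p≈q i)) (sym (coeff-neg q i)))
          }
        ; comm = λ p q i → trans (coeff-+ p q i) (trans (ℚ.+-comm (coeff p i) _) (sym (coeff-+ q p i)))
        }
      ; *-cong = λ {p} {q} {r} {s} → *ₚ-cong {p} {q} {r} {s}
      ; *-assoc = *ₚ-assoc
      ; *-identity = *ₚ-identityˡ , λ p i → trans (*ₚ-comm p (const 1ℚ) i) (*ₚ-identityˡ p i)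
      ; distrib = *ₚ-distribˡ , *ₚ-distribʳ
      }
    ; *-comm = *ₚ-comm
    }
  }
  where
  assoc : ∀ p q r → (p +ₚ q) +ₚ r ≈ₚ p +ₚ (q +ₚ r)
  assoc p q r i = begin
    coeff ((p +ₚ q) +ₚ r) i                  ≡⟨ coeff-+ (p +ₚ q) r i ⟩
    coeff (p +ₚ q) i ℚ.+ coeff r i           ≡⟨ cong (ℚ._+ coeff r i) (coeff-+ p q i) ⟩
    coeff p i ℚ.+ coeff q i ℚ.+ coeff r i    ≡⟨ ℚ.+-assoc (coeff p i) _ _ ⟩
    coeff p i ℚ.+ (coeff q i ℚ.+ coeff r i)  ≡⟨ cong (coeff p i ℚ.+_) (coeff-+ q r i) ⟨
    coeff p i ℚ.+ coeff (q +ₚ r) i           ≡⟨ coeff-+ p (q +ₚ r) i ⟨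
    coeff (p +ₚ (q +ₚ r)) i                  ∎
    where open ≡.≡-Reasoning

-- Ring laws for fractions, as identities between numerators and denominators

module FractionLaws (K : CommutativeRing 0ℓ 0ℓ) where
  open CommutativeRing K renaming (refl to ≈-refl; sym to ≈-sym; trans to ≈-trans) hiding (_-_)
  open import Algebra.Solver.Ring.NaturalCoefficients.Default commutativeSemiring
    using (solve; _:=_; _:+_; _:*_; con)
  open import Algebra.Properties.Ring ring using (-‿distribˡ-*)

  open import Relation.Binary.Reasoning.Setoid setoid

  difference≈0 : ∀ x y → x + (- y) ≈ 0# → x ≈ y
  difference≈0 x y x-y≈0 = begin
    x                ≈⟨ +-identityʳ x ⟨
    x + 0#           ≈⟨ +-congˡ (-‿inverseˡ y) ⟨
    x + ((- y) + y)  ≈⟨ +-assoc x (- y) y ⟨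
    x + (- y) + y    ≈⟨ +-congʳ x-y≈0 ⟩
    0# + y           ≈⟨ +-identityˡ y ⟩
    y                ∎

  -- Transitivity of a/b ≈ c/d ≈ e/f, multiplied by the denominator d.
  trans-law : ∀ a b c d e f → a * d ≈ c * b → c * f ≈ e * d → d * (a * f + (- (e * b))) ≈ 0#
  trans-law a b c d e f ad≈cb cf≈ed = begin
    d * (a * f + (- (e * b)))        ≈⟨ distribˡ d _ _ ⟩
    d * (a * f) + d * (- (e * b))    ≈⟨ +-congʳ adf ⟩
    d * (e * b) + d * (- (e * b))    ≈⟨ distribˡ d _ _ ⟨
    d * (e * b + (- (e * b)))        ≈⟨ *-congˡ (-‿inverseʳ (e * b)) ⟩
    d * 0#                           ≈⟨ zeroʳ d ⟩
    0#                               ∎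
    where
    adf : d * (a * f) ≈ d * (e * b)
    adf = begin
      d * (a * f)   ≈⟨ solve 3 (λ d a f → d :* (a :* f) := a :* d :* f) ≈-refl d a f ⟩
      a * d * f     ≈⟨ *-congʳ ad≈cb ⟩
      c * b * f     ≈⟨ solve 3 (λ c b f → c :* b :* f := c :* f :* b) ≈-refl c b f ⟩
      c * f * b     ≈⟨ *-congʳ cf≈ed ⟩
      e * d * b     ≈⟨ solve 3 (λ e d b → e :* d :* b := d :* (e :* b)) ≈-refl e d b ⟩
      d * (e * b)   ∎

  +-cong-law : ∀ a b a′ b′ c d c′ d′ → a * b′ ≈ a′ * b → c * d′ ≈ c′ * d →
               (a * d + c * b) * (b′ * d′) ≈ (a′ * d′ + c′ * b′) * (b * d)
  +-cong-law a b a′ b′ c d c′ d′ eq₁ eq₂ = begin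
    (a * d + c * b) * (b′ * d′)
      ≈⟨ solve 6 (λ a b b′ c d d′ → (a :* d :+ c :* b) :* (b′ :* d′) := (a :* b′) :* (d :* d′) :+ (c :* d′) :* (b :* b′)) ≈-refl a b b′ c d d′ ⟩
    (a * b′) * (d * d′) + (c * d′) * (b * b′)
      ≈⟨ +-cong (*-congʳ eq₁) (*-congʳ eq₂) ⟩
    (a′ * b) * (d * d′) + (c′ * d) * (b * b′)
      ≈⟨ solve 6 (λ a′ b b′ c′ d d′ → (a′ :* b) :* (d :* d′) :+ (c′ :* d) :* (b :* b′) := (a′ :* d′ :+ c′ :* b′) :* (b :* d)) ≈-refl a′ b b′ c′ d d′ ⟩
    (a′ * d′ + c′ * b′) * (b * d) ∎

  *-cong-law : ∀ a b a′ b′ c d c′ d′ → a * b′ ≈ a′ * b → c * d′ ≈ c′ * d →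
               (a * c) * (b′ * d′) ≈ (a′ * c′) * (b * d)
  *-cong-law a b a′ b′ c d c′ d′ eq₁ eq₂ = begin
    (a * c) * (b′ * d′)   ≈⟨ solve 4 (λ a c b′ d′ → (a :* c) :* (b′ :* d′) := (a :* b′) :* (c :* d′)) ≈-refl a c b′ d′ ⟩
    (a * b′) * (c * d′)   ≈⟨ *-cong eq₁ eq₂ ⟩
    (a′ * b) * (c′ * d)   ≈⟨ solve 4 (λ a c b d → (a :* b) :* (c :* d) := (a :* c) :* (b :* d)) ≈-refl a′ c′ b d ⟩
    (a′ * c′) * (b * d)   ∎

  +-assoc-law : ∀ a b c d e f →
    ((a * d + c * b) * f + e * (b * d)) * (b * (d * f)) ≈ (a * (d * f) + (c * f + e * d) * b) * (b * d * f)
  +-assoc-law = solve 6 (λ a b c d e f →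
    ((a :* d :+ c :* b) :* f :+ e :* (b :* d)) :* (b :* (d :* f)) :=
    (a :* (d :* f) :+ (c :* f :+ e :* d) :* b) :* (b :* d :* f)) ≈-refl

  +-identityˡ-law : ∀ a b → (0# * b + a * 1#) * b ≈ a * (1# * b)
  +-identityˡ-law = solve 2 (λ a b → (con 0 :* b :+ a :* con 1) :* b := a :* (con 1 :* b)) ≈-refl

  +-identityʳ-law : ∀ a b → (a * 1# + 0# * b) * b ≈ a * (b * 1#)
  +-identityʳ-law = solve 2 (λ a b → (a :* con 1 :+ con 0 :* b) :* b := a :* (b :* con 1)) ≈-refl

  +-comm-law : ∀ a b c d → (a * d + c * b) * (d * b) ≈ (c * b + a * d) * (b * d)
  +-comm-law = solve 4 (λ a b c d → (a :* d :+ c :* b) :* (d :* b) := (c :* b :+ a :* d) :* (b :* d)) ≈-refl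

  inverseˡ-law : ∀ a b → ((- a) * b + a * b) * 1# ≈ 0# * (b * b)
  inverseˡ-law a b = begin
    ((- a) * b + a * b) * 1#   ≈⟨ solve 3 (λ n a b → (n :* b :+ a :* b) :* con 1 := (n :+ a) :* b) ≈-refl (- a) a b ⟩
    ((- a) + a) * b            ≈⟨ *-congʳ (-‿inverseˡ a) ⟩
    0# * b                     ≈⟨ solve 1 (λ b → con 0 :* b := con 0 :* (b :* b)) ≈-refl b ⟩
    0# * (b * b)               ∎

  inverseʳ-law : ∀ a b → (a * b + (- a) * b) * 1# ≈ 0# * (b * b)
  inverseʳ-law a b = ≈-trans (*-congʳ (+-comm _ _)) (inverseˡ-law a b)

  neg-cong-law : ∀ a b c d → a * d ≈ c * b → (- a) * d ≈ (- c) * b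
  neg-cong-law a b c d eq = ≈-trans (≈-sym (-‿distribˡ-* a d)) (≈-trans (-‿cong eq) (-‿distribˡ-* c b))

  *-assoc-law : ∀ a b c d e f → (a * c * e) * (b * (d * f)) ≈ (a * (c * e)) * (b * d * f)
  *-assoc-law = solve 6 (λ a b c d e f → (a :* c :* e) :* (b :* (d :* f)) := (a :* (c :* e)) :* (b :* d :* f)) ≈-refl

  *-identityˡ-law : ∀ a b → (1# * a) * b ≈ a * (1# * b)
  *-identityˡ-law = solve 2 (λ a b → (con 1 :* a) :* b := a :* (con 1 :* b)) ≈-refl

  *-identityʳ-law : ∀ a b → (a * 1#) * b ≈ a * (b * 1#)
  *-identityʳ-law = solve 2 (λ a b → (a :* con 1) :* b := a :* (b :* con 1)) ≈-refl

  *-comm-law : ∀ a b c d → (a * c) * (d * b) ≈ (c * a) * (b * d)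
  *-comm-law = solve 4 (λ a b c d → (a :* c) :* (d :* b) := (c :* a) :* (b :* d)) ≈-refl

  distribˡ-law : ∀ a b c d e f →
    (a * (c * f + e * d)) * ((b * d) * (b * f)) ≈ ((a * c) * (b * f) + (a * e) * (b * d)) * (b * (d * f))
  distribˡ-law = solve 6 (λ a b c d e f →
    (a :* (c :* f :+ e :* d)) :* ((b :* d) :* (b :* f)) :=
    ((a :* c) :* (b :* f) :+ (a :* e) :* (b :* d)) :* (b :* (d :* f))) ≈-refl

  distribʳ-law : ∀ a b c d e f →
    ((c * f + e * d) * a) * ((d * b) * (f * b)) ≈ ((c * a) * (f * b) + (e * a) * (d * b)) * ((d * f) * b)
  distribʳ-law = solve 6 (λ a b c d e f →
    ((c :* f :+ e :* d) :* a) :* ((d :* b) :* (f :* b)) :=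
    ((c :* a) :* (f :* b) :+ (e :* a) :* (d :* b)) :* ((d :* f) :* b)) ≈-refl

  -- The cross-multiplied form of z (1 + x) = x for z = x/(1 + x); the factors `1#` come from the
  -- denominators of 1 and x.
  x/[1+x]-law : ∀ x → x * (1# * 1# + x * 1#) * 1# ≈ x * ((1# + x) * (1# * 1#))
  x/[1+x]-law = solve 1 (λ x → x :* (con 1 :* con 1 :+ x :* con 1) :* con 1 :=
                               x :* ((con 1 :+ x) :* (con 1 :* con 1))) ≈-refl

open Fraction

module ℚ[x]-Laws = FractionLaws polynomialRing

fractionField : CommutativeRing 0ℓ 0ℓ
fractionField = record
  { RawRing ℚ⟨x⟩
  ; isCommutativeRing = record
    { isRing = record
      { +-isAbelianGroup = record
        { isGroup = record
          { isMonoid = record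
            { isSemigroup = record
              { isMagma = record
                { isEquivalence = record
                  { refl  = λ i → refl
                  ; sym   = λ u≈v i → sym (u≈v i)
                  -- The one law that needs cancellation: the middle denominator is removed using
                  -- that ℚ[x] has no zero divisors.
                  ; trans = λ {u} {v} {w} u≈v v≈w →
                      difference≈0 (num u *ₚ den w) (num w *ₚ den u)
                        (*ₚ-cancel (den v) _ (nonZero v)
                          (trans-law (num u) (den u) (num v) (den v) (num w) (den w) u≈v v≈w))
                  }
                ; ∙-cong = λ {u} {u′} {v} {v′} → +-cong-law (num u) (den u) (num u′) (den u′) (num v) (den v) (num v′) (den v′)
                }
              ; assoc = λ u v w → +-assoc-law (num u) (den u) (num v) (den v) (num w) (den w)
              }
            ; identity = (λ u → +-identityˡ-law (num u) (den u)) , (λ u → +-identityʳ-law (num u) (den u))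
            }
          ; inverse = (λ u → inverseˡ-law (num u) (den u)) , (λ u → inverseʳ-law (num u) (den u))
          ; ⁻¹-cong = λ {u} {v} → neg-cong-law (num u) (den u) (num v) (den v)
          }
        ; comm = λ u v → +-comm-law (num u) (den u) (num v) (den v)
        }
      ; *-cong = λ {u} {u′} {v} {v′} → *-cong-law (num u) (den u) (num u′) (den u′) (num v) (den v) (num v′) (den v′)
      ; *-assoc = λ u v w → *-assoc-law (num u) (den u) (num v) (den v) (num w) (den w)
      ; *-identity = (λ u → *-identityˡ-law (num u) (den u)) , (λ u → *-identityʳ-law (num u) (den u))
      ; distrib = (λ u v w → distribˡ-law (num u) (den u) (num v) (den v) (num w) (den w))
                , (λ u v w → distribʳ-law (num u) (den u) (num v) (den v) (num w) (den w))
      }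
    ; *-comm = λ u v → *-comm-law (num u) (den u) (num v) (den v)
    }
  }
  where
  open ℚ[x]-Laws

theorem10 : ∀ (n : ℕ) → 2 ≤ n →
    (let open InRing ℚ[x] in
    D n X ≈ const ½ * (∑[ k ∈ interval 1 (n ∸ 1) ] r n k · (X ^ k * (1# - X) ^ (n ∸ 1 ∸ k))))
    ×
    (let open InRing ℚ⟨x⟩ in
    R n ⟦ X ⟧ ≈ 2 · ((1# + ⟦ X ⟧) ^ (n ∸ 1) * D n X/[1+X]))
theorem10 (suc (suc n)) (s≤s (s≤s z≤n)) =
  Specialise.D-from-R polynomialRing n (const ½) X (λ { zero → refl ; (suc i) → refl }) ,
  Specialise.R-from-D fractionField n ⟦ X ⟧ X/[1+X] (ℚ[x]-Laws.x/[1+x]-law X)
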